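{- Let $m>1$, let $p=(p_1,\dots,p_m)\in\{0,1\}^m$ be a binary vector whose zeros are located exactly at the positions $i_1<i_2<\dots<i_r$, with $i_r=m$, and let $\mathcal P=(p)^*=(p_1,p_2,p_3,\dots)$ be the infinite periodic up-down sequence with period $p$, so $p_{i+m}=p_i$ for all $i\ge 1$. Then the exponential generating function of the signed periodic de Bruijn triangle corresponding to $\mathcal P$, $$F^{\mathcal P}(x,y)=\sum_{i\ge 1}\sum_{j=1}^{i}\varepsilon_i\,\sharp^{\mathcal P}_{i,j}\,\frac{x^{i-j}y^{j-1}}{(i-j)!\,(j-1)!},$$ is given by $$F^{\mathcal P}(x,y)=e^{y}f^{\mathcal P}(x+y),\qquad f^{\mathcal P}(t)=\frac{\det\bar M^{\mathcal P}(t)}{\det M^{\mathcal P}(t)},$$ where $M^{\mathcal P}(t)$ and $\bar M^{\mathcal P}(t)$ are the $r\times r$ matrices $$M^{\mathcal P}(t)=\begin{pmatrix} \varphi_{m,0}&\varphi_{m,m-i_1}&\varphi_{m,m-i_2}&\cdots&\varphi_{m,m-i_{r-1}}\\ \varphi_{m,i_1}&\varphi_{m,0}&\varphi_{m,m+i_1-i_2}&\cdots&\varphi_{m,m+i_1-i_{r-1}}\\ \varphi_{m,i_2}&\varphi_{m,i_2-i_1}&\varphi_{m,0}&\cdots&\varphi_{m,m+i_2-i_{r-1}}\\ \vdots&\vdots&\vdots&\ddots&\vdots\\ \varphi_{m,i_{r-1}}&\varphi_{m,i_{r-1}-i_1}&\varphi_{m,i_{r-1}-i_2}&\cdots&\varphi_{m,0}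 \end{pmatrix}$$ and $$\bar M^{\mathcal P}(t)=\begin{pmatrix} 1&1&1&\cdots&1\\ \varphi_{m,i_1}&\varphi_{m,0}&\varphi_{m,m+i_1-i_2}&\cdots&\varphi_{m,m+i_1-i_{r-1}}\\ \varphi_{m,i_2}&\varphi_{m,i_2-i_1}&\varphi_{m,0}&\cdots&\varphi_{m,m+i_2-i_{r-1}}\\ \vdots&\vdots&\vdots&\ddots&\vdots\\ \varphi_{m,i_{r-1}}&\varphi_{m,i_{r-1}-i_1}&\varphi_{m,i_{r-1}-i_2}&\cdots&\varphi_{m,0} \end{pmatrix}$$ with $\varphi_{m,j}=\varphi_{m,j}(t)$.
   Context: The up-down sequence of a permutation $\sigma=(\sigma_1,\dots,\sigma_n)$ of $\{1,\dots,n\}$ is the binary vector of length $n-1$ whose $i$-th entry is $1$ if $\sigma_i<\sigma_{i+1}$ and $0$ otherwise. For an infinite binary sequence $\mathcal P=(p_1,p_2,\dots)$, $\sharp^{\mathcal P}_{i,j}$ ($1\le j\le i$) is the number of permutations of length $i$ whose up-down sequence is $(p_1,\dots,p_{i-1})$ and whose last entry equals $j$; in particular $\sharp^{\mathcal P}_{1,1}=1$. The triangular array $(\sharp^{\mathcal P}_{i,j})$ is the de Bruijn triangle of $\mathcal P$. The signed de Bruijn triangle is obtained by multiplying its $i$-th row by $\varepsilon_i=(-1)^{\bar p_1+\bar p_2+\dots+\bar p_{i-1}}$, where $\bar p_k=1-p_k$ (so $\varepsilon_1=1$). The Olivier functions of the $m$-th order are $\varphi_{m,i}(t)=\sum_{j=0}^{\infty}\frac{t^{jm+i}}{(jm+i)!}$,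 $0\le i\le m-1$. Setting $i_0=0$ and indexing rows and columns by $k,l\in\{0,\dots,r-1\}$, the $(k,l)$ entry of $M^{\mathcal P}(t)$ is $\varphi_{m,(i_k-i_l)\bmod m}(t)$ with the residue taken in $\{0,\dots,m-1\}$; $\bar M^{\mathcal P}(t)$ is obtained from $M^{\mathcal P}(t)$ by replacing the first row by ones. For $r=1$, $M^{\mathcal P}=(\varphi_{m,0})$ and $\bar M^{\mathcal P}=(1)$. Identities between generating functions are identities of formal power series. -}

module Defs where

open import Algebra.Bundles using (RawRing)
import Algebra.Definitions
open import Algebra.Definitions.RawSemiring using (_^_; sum)
open import Data.Bool.Base using (Bool; true; false; if_then_else_)
import Data.Bool.Properties as Bool
open import Data.Fin.Base as Fin using (Fin; toℕ; inject₁; punchIn)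
import Data.Fin.Properties as Fin
open import Data.Integer.Base as ℤ using (ℤ; +_; -1ℤ; _%ℕ_)
open import Data.List.Base as List using (List; length; filter; allFin; cartesianProductWith)
open import Data.Nat.Base as ℕ using (ℕ; zero; suc; NonZero; _∸_; _≡ᵇ_; _!)
import Data.Nat.Properties as ℕ
open import Data.Nat.DivMod using (_mod_)
open import Data.Product.Base using (_×_; proj₁)
open import Data.Rational.Base as ℚ using (ℚ)
open import Data.Vec.Base as Vec using (Vec; []; _∷_; lookup; tabulate)
import Data.Vec.Properties as Vec
import Data.Vec.Functional as Vector
open import Data.Vec.Relation.Unary.AllPairs using (allPairs?)
open import Data.Vec.Relation.Unary.Unique.Propositional using (Unique)
open import Function.Base using (_∘_)
open import Relation.Binary.PropositionalEquality.Core using (_≡_)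
open import Relation.Nullary.Decidable using (does; ¬?; _×-dec_)
open import Relation.Unary using (Decidable)

module PowerSeries {c ℓ} (R : RawRing c ℓ) where
  open RawRing R

  monomial : Carrier → ℕ → (ℕ → Carrier)
  monomial a k n = if k ≡ᵇ n then a else 0#

  constant : Carrier → (ℕ → Carrier)
  constant a = monomial a 0

  X : ℕ → Carrier
  X = monomial 1# 1

  rawRing : RawRing c ℓ
  rawRing = record
    { Carrier = ℕ → Carrier
    ; _≈_     = λ f g → ∀ n → f n ≈ g n
    ; _+_     = λ f g n → f n + g n
    ; _*_     = λ f g n →
        sum rawSemiring {suc n} λ k → f (toℕ k) * g (n ∸ toℕ k)
    ; -_      = λ f n → - f n
    ; 0#      = λ _ → 0#
    ; 1#      = constant 1#
    }

module Determinant {c ℓ} (R : RawRing c ℓ) where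
  open RawRing R

  det : ∀ {n} → (Fin n → Fin n → Carrier) → Carrier
  det {zero}  A = 1#
  det {suc n} A = sum rawSemiring λ j →
    _^_ rawSemiring (- 1#) (toℕ j) *
      (A Fin.zero j * det (λ k l → A (Fin.suc k) (punchIn j l)))

ℚ⟦t⟧ : RawRing _ _
ℚ⟦t⟧ = PowerSeries.rawRing ℚ.+-*-rawRing

-- Represented as ℚ⟦y⟧⟦x⟧: G a b is the coefficient of xᵃyᵇ in G.
ℚ⟦x,y⟧ : RawRing _ _
ℚ⟦x,y⟧ = PowerSeries.rawRing ℚ⟦t⟧

module ℚ⟦t⟧ = RawRing ℚ⟦t⟧
module ℚ⟦x,y⟧ = RawRing ℚ⟦x,y⟧

-- A series in one variable regarded as a series in y.
inY : ℚ⟦t⟧.Carrier → ℚ⟦x,y⟧.Carrier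
inY = PowerSeries.constant ℚ⟦t⟧

x y : ℚ⟦x,y⟧.Carrier
x = PowerSeries.X ℚ⟦t⟧
y = inY (PowerSeries.X ℚ.+-*-rawRing)

-- Substitution f(g) = Σₙ fₙ gⁿ, for g without constant term: then gⁿ has
-- no terms of total degree less than n, so only n ≤ a + b contribute to
-- the coefficient of xᵃyᵇ.
_⟨_⟩ : ℚ⟦t⟧.Carrier → ℚ⟦x,y⟧.Carrier → ℚ⟦x,y⟧.Carrier
(f ⟨ g ⟩) a b = sum (RawRing.rawSemiring ℚ.+-*-rawRing) {suc (a ℕ.+ b)}
  λ n → f (toℕ n) ℚ.* _^_ ℚ⟦x,y⟧.rawSemiring g (toℕ n) a b

1/[_]! : ℕ → ℚ
1/[ n ]! = ((+ 1) ℚ./ (n !)) {{n ℕ.!≢0}}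

exp : ℚ⟦t⟧.Carrier
exp n = 1/[ n ]!

Unit : ℚ⟦t⟧.Carrier → Set
Unit = Invertible 1# _*_
  where open ℚ⟦t⟧
        open Algebra.Definitions _≈_

quotient : (g h : ℚ⟦t⟧.Carrier) → Unit h → ℚ⟦t⟧.Carrier
quotient g h u = g ℚ⟦t⟧.* proj₁ u

words : ∀ n k → List (Vec (Fin n) k)
words n zero    = List.[ [] ]
words n (suc k) = cartesianProductWith _∷_ (allFin n) (words n k)

upDown : ∀ {m n} → Vec (Fin m) (suc n) → Vec Bool n
upDown σ = tabulate λ k →
  does (lookup σ (inject₁ k) Fin.<? lookup σ (Fin.suc k))

-- An infinite binary sequence (p₁, p₂, …) is a function P with P k = pₖ₊₁,
-- where true stands for 1 and false for 0.
--
-- A permutation of {1,…,n} is a vector of n distinct elements of Fin n,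
-- with v : Fin n standing for the value toℕ v + 1.
Counted : (ℕ → Bool) → ∀ n → ℕ → Vec (Fin (suc n)) (suc n) → Set
Counted P n j σ =
  Unique σ × upDown σ ≡ tabulate (P ∘ toℕ) × suc (toℕ (Vec.last σ)) ≡ j

counted? : ∀ P n j → Decidable (Counted P n j)
counted? P n j σ =
  allPairs? (λ u v → ¬? (u Fin.≟ v)) σ
  ×-dec Vec.≡-dec Bool._≟_ (upDown σ) (tabulate (P ∘ toℕ))
  ×-dec (suc (toℕ (Vec.last σ)) ℕ.≟ j)

♯ : (ℕ → Bool) → ℕ → ℕ → ℕ
♯ P zero    j = 0
♯ P (suc n) j = length (filter (counted? P n j) (words (suc n) (suc n)))

p̄ : Bool → ℕ
p̄ true  = 0
p̄ false = 1

ε : (ℕ → Bool) → ℕ → ℤ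
ε P i = -1ℤ ℤ.^ Vec.sum (tabulate {n = i ∸ 1} λ k → p̄ (P (toℕ k)))

-- xᵃyᵇ arises exactly from the index pair i = a + b + 1, j = b + 1.
F : (ℕ → Bool) → ℚ⟦x,y⟧.Carrier
F P a b =
  ((ε P i ℤ.* (+ ♯ P i j)) ℚ./ ((i ∸ j) ! ℕ.* (j ∸ 1) !))
    {{ (i ∸ j) ℕ.!* (j ∸ 1) !≢0 }}
  where
  i = suc (a ℕ.+ b)
  j = suc b

periodic : ∀ {m} .{{_ : NonZero m}} → Vec Bool m → ℕ → Bool
periodic {m} p k = lookup p (k mod m)

-- Σⱼ t^(jm+i)/(jm+i)!; for m ≥ 1 only the terms with j ≤ n contribute to
-- the coefficient of tⁿ.
φ : ℕ → ℕ → ℚ⟦t⟧.Carrier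
φ m i n = sum (RawRing.rawSemiring ℚ.+-*-rawRing) {suc n} λ j →
  PowerSeries.monomial ℚ.+-*-rawRing
    1/[ toℕ j ℕ.* m ℕ.+ i ]! (toℕ j ℕ.* m ℕ.+ i) n

-- The sequence i₀ = 0, i₁, …, iᵣ, given the zero-based indices of the
-- positions i₁, …, iᵣ.
positions : ∀ {m r} → (Fin r → Fin m) → Fin (suc r) → ℕ
positions z = 0 Vector.∷ (λ s → suc (toℕ (z s)))

module _ (m : ℕ) .{{_ : NonZero m}} {r : ℕ} (i : Fin (suc r) → ℕ) where

  M : Fin r → Fin r → ℚ⟦t⟧.Carrier
  M k l = φ m (((+ i (inject₁ k)) ℤ.- (+ i (inject₁ l))) %ℕ m)

  M̄ : Fin r → Fin r → ℚ⟦t⟧.Carrier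
  M̄ Fin.zero    l = ℚ⟦t⟧.1#
  M̄ (Fin.suc k) l = M (Fin.suc k) l

open Determinant ℚ⟦t⟧ public using (det)

{-# OPTIONS --safe #-}
-- Write c(a,b) = ε ♯ for the entry with i = a + b + 1, j = b + 1.  The signs
-- turn the recurrences for an ascent and for a descent at the end of the
-- permutation into the single one c(a,b+1) = c(a+1,b) + c(a,b), whose solution
-- is F(x,y) = e^y f(x + y) with f(t) = F(t,0).  The boundary values say that,
-- apart from the constant terms, f has exponents only at zeros of p, and
-- F(0,t) = e^t f(t) has none there.  Splitting f = Σ_l f_l by the residues i_l
-- of the exponents, the components of e^t f at the residues i_k read
-- Σ_l M_kl f_l = δ_k0, and Cramer's rule gives f · det M = det M̄.
module Submission where

open import Defs
open import Algebra.Bundles using (CommutativeRing; RawRing)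
open import Data.Bool.Base using (Bool; true; false; if_then_else_; T)
import Data.Bool.Properties as Bool
open import Data.Empty using (⊥-elim)
open import Data.Fin.Base as Fin using (Fin; zero; suc; toℕ; fromℕ; fromℕ<; inject₁; punchIn; punchOut)
import Data.Fin.Properties as Fin
open import Data.Fin.Relation.Unary.Top using (view; ‵fromℕ; ‵inject₁)
open import Data.Integer.Base as ℤ using (ℤ; +_; -[1+_]; -1ℤ; 1ℤ; _%ℕ_; _/ℕ_)
open import Data.Integer.DivMod using (n%ℕd<d; a≡a%ℕn+[a/ℕn]*n)
import Data.Integer.Properties as ℤ
open import Data.List.Base as List using (List; []; _∷_; length; filter)
open import Data.List.Membership.Propositional using (_∈_)
import Data.List.Membership.Propositional.Properties as ∈
open import Data.List.Membership.Setoid.Properties using (unique⇒irrelevant)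
import Data.List.Properties as List
open import Data.List.Relation.Binary.BagAndSetEquality using (∼bag⇒↭)
open import Data.List.Relation.Binary.Permutation.Propositional.Properties using (↭-length)
import Data.List.Relation.Unary.All as ListAll
import Data.List.Relation.Unary.AllPairs as ListAllPairs
open import Data.List.Relation.Unary.Any using (here)
import Data.List.Relation.Unary.Unique.Propositional as List
import Data.List.Relation.Unary.Unique.Propositional.Properties as ListUnique
open import Data.Nat.Base as ℕ using (ℕ; zero; suc; _∸_; _!; _≡ᵇ_; NonZero)
open import Data.Nat.DivMod as ℕ using (_%_; _/_; _mod_)
import Data.Nat.Properties as ℕ
open import Data.Product.Base using (Σ-syntax; ∃; ∃-syntax; _×_; _,_; proj₁; proj₂)
open import Data.Rational.Base as ℚ using (ℚ; 0ℚ; 1ℚ; fromℚᵘ)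
import Data.Rational.Properties as ℚ
open import Data.Rational.Unnormalised.Base as ℚᵘ using (mkℚᵘ; *≡*)
import Data.Rational.Unnormalised.Properties as ℚᵘ
open import Data.Sum.Base using (_⊎_; inj₁; inj₂)
open import Data.Vec.Base as Vec using (Vec; []; _∷_; _∷ʳ_; last; lookup; tabulate; initLast)
open import Data.Vec.Functional using (updateAt)
open import Data.Vec.Functional.Properties using (updateAt-updates; updateAt-minimal)
import Data.Vec.Properties as Vec
open import Data.Vec.Relation.Unary.All as All using (All; []; _∷_)
import Data.Vec.Relation.Unary.All.Properties as All
open import Data.Vec.Relation.Unary.AllPairs using (allPairs?; []; _∷_)
open import Data.Vec.Relation.Unary.Unique.Propositional using (Unique)
import Data.Vec.Relation.Unary.Unique.Propositional.Properties as Unique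
open import Function.Base using (_∘_; const)
open import Function.Bundles using (_⇔_; Equivalence; mk⇔; mk↔ₛ′)
open import Level using (0ℓ)
open import Relation.Binary.Core using (_Preserves_⟶_)
open import Relation.Binary.Definitions using (tri<; tri≈; tri>)
open import Relation.Binary.PropositionalEquality as ≡ using (_≡_; _≢_)
open import Relation.Nullary using (Dec; yes; no; ¬_; does; ¬?; _×-dec_)
open import Relation.Nullary.Decidable using (dec-true; dec-false; does-⇔)
open import Relation.Unary using (Pred; Decidable)

-- Formal power series

-- An ascent cannot end in the smallest value nor a descent in the largest, so `P n` decides which
-- of the two coefficients of t^(n+1), in F(t,0) or in F(0,t), is forced to vanish. Only the
-- permutation of length 1 has no last step: it puts the constant term 1 into both series, and this
-- is the 1 on the right-hand side of the system. Since i_r = m is congruent to i_0 = 0, the last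
-- zero of the period falls into the residue class of the constant term; that leaves r classes for
-- the exponents of f, and the system is square. The row of ones in det M̄ adds up the unknowns:
-- expansion along it sums the cofactors of the first row of M, and each of these is one f_l times
-- det M. The quotient makes sense because M becomes the identity matrix at t = 0.

module FiniteSums {c ℓ} (R : CommutativeRing c ℓ) where
  open CommutativeRing R hiding (zero)
  open import Algebra.Properties.Semiring.Sum semiring public
  open import Relation.Binary.Reasoning.Setoid setoid

  sum-cong : ∀ {n} (s t : Fin n → Carrier) → (∀ j → s j ≈ t j) → sum s ≈ sum t
  sum-cong s t = sum-cong-≋

  sum-zero : ∀ {n} (t : Fin n → Carrier) → (∀ j → t j ≈ 0#) → sum t ≈ 0#
  sum-zero {n} t t≈0 = trans (sum-cong-≋ t≈0) (sum-replicate-zero n)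

  sum-single : ∀ {n} (i : Fin n) (t : Fin n → Carrier) →
               (∀ j → j ≢ i → t j ≈ 0#) → sum t ≈ t i
  sum-single {suc n} i t t≈0 = begin
    sum t                             ≈⟨ sum-remove {i = i} t ⟩
    t i + sum (λ k → t (punchIn i k)) ≈⟨ +-congˡ (sum-zero (t ∘ punchIn i) λ k → t≈0 _ (Fin.punchInᵢ≢i i k)) ⟩
    t i + 0#                          ≈⟨ +-identityʳ _ ⟩
    t i                               ∎

  sum-adjacent : ∀ {n} (q : Fin n) (t : Fin (suc n) → Carrier) →
                 t (inject₁ q) + t (suc q) ≈ 0# →
                 (∀ j → j ≢ inject₁ q → j ≢ suc q → t j ≈ 0#) → sum t ≈ 0#
  sum-adjacent {suc n} zero t eq t≈0 = begin
    t zero + (t (suc zero) + sum (λ j → t (suc (suc j)))) ≈⟨ +-assoc _ _ _ ⟨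
    (t zero + t (suc zero)) + sum (λ j → t (suc (suc j)))
      ≈⟨ +-cong eq (sum-zero (λ j → t (suc (suc j))) λ j → t≈0 _ (λ ()) (λ ())) ⟩
    0# + 0#                                               ≈⟨ +-identityʳ _ ⟩
    0#                                                    ∎
  sum-adjacent {suc n} (suc q) t eq t≈0 = begin
    t zero + sum (t ∘ suc) ≈⟨ +-cong (t≈0 _ (λ ()) (λ ())) (sum-adjacent q (t ∘ suc) eq
                                λ j p r → t≈0 _ (p ∘ Fin.suc-injective) (r ∘ Fin.suc-injective)) ⟩
    0# + 0#                ≈⟨ +-identityʳ _ ⟩
    0#                     ∎

module PowerSeriesRing {c ℓ} (R : CommutativeRing c ℓ) where
  open CommutativeRing R hiding (zero)
  open FiniteSums R
  open import Relation.Binary.Reasoning.Setoid setoid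

  private
    module P = PowerSeries rawRing

    Series : Set c
    Series = ℕ → Carrier

    module S = RawRing P.rawRing

  term : Series → Series → ∀ n → Fin (suc n) → Carrier
  term f g n k = f (toℕ k) * g (n ∸ toℕ k)

  -- Finer than congruence: the factors may differ wherever the products of total degree n do not
  -- notice it. The linear system relies on this to exchange Olivier functions for e^t beside a
  -- series supported on one residue class.
  ⋆-local : ∀ (f f′ g g′ : Series) n →
            (∀ a b → a ℕ.+ b ≡ n → f a * g b ≈ f′ a * g′ b) →
            (f S.* g) n ≈ (f′ S.* g′) n
  ⋆-local f f′ g g′ n eq = sum-cong (term f g n) (term f′ g′ n) λ k →
    eq (toℕ k) (n ∸ toℕ k) (ℕ.m+[n∸m]≡n (ℕ.≤-pred (Fin.toℕ<n k)))

  ⋆-cong : ∀ f f′ g g′ → f S.≈ f′ → g S.≈ g′ → f S.* g S.≈ f′ S.* g′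
  ⋆-cong f f′ g g′ p q n = ⋆-local f f′ g g′ n λ a b _ → *-cong (p a) (q b)

  ⋆-zeroˡ : ∀ f g → (∀ n → f n ≈ 0#) → ∀ n → (f S.* g) n ≈ 0#
  ⋆-zeroˡ f g f≈0 n = sum-zero (term f g n) λ k → trans (*-congʳ (f≈0 _)) (zeroˡ _)

  -- The definition of the product peels off the lowest coefficient of the left factor; this is the
  -- mirror image, which the induction for commutativity needs.
  ⋆-sucʳ : ∀ f g n → (f S.* g) (suc n) ≈ (f S.* (g ∘ suc)) n + f (suc n) * g 0
  ⋆-sucʳ f g zero = trans (sym (+-assoc _ _ _)) (trans (+-identityʳ _) (+-congʳ (sym (+-identityʳ _))))
  ⋆-sucʳ f g (suc n) = trans (+-congˡ (⋆-sucʳ (f ∘ suc) g n)) (sym (+-assoc _ _ _))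

  ⋆-comm : ∀ f g → f S.* g S.≈ g S.* f
  ⋆-comm f g zero    = +-congʳ (*-comm _ _)
  ⋆-comm f g (suc n) = begin
    f 0 * g (suc n) + ((f ∘ suc) S.* g) n ≈⟨ +-comm _ _ ⟩
    ((f ∘ suc) S.* g) n + f 0 * g (suc n) ≈⟨ +-cong (⋆-comm (f ∘ suc) g n) (*-comm _ _) ⟩
    (g S.* (f ∘ suc)) n + g (suc n) * f 0 ≈⟨ ⋆-sucʳ g f n ⟨
    (g S.* f) (suc n)                     ∎

  ⋆-distribʳ : ∀ h f g → (f S.+ g) S.* h S.≈ f S.* h S.+ g S.* h
  ⋆-distribʳ h f g n = trans
    (sum-cong (term (f S.+ g) h n) (λ k → term f h n k + term g h n k) λ k → distribʳ _ _ _)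
    (∑-distrib-+ (term f h n) (term g h n))

  ⋆-scaleˡ : ∀ a f g n → ((λ k → a * f k) S.* g) n ≈ a * (f S.* g) n
  ⋆-scaleˡ a f g n = trans
    (sum-cong (term (λ k → a * f k) g n) (λ k → a * term f g n k) λ k → *-assoc _ _ _)
    (sym (*-distribˡ-sum a (term f g n)))

  ⋆-assoc : ∀ f g h → (f S.* g) S.* h S.≈ f S.* (g S.* h)
  ⋆-assoc f g h zero = begin
    (f 0 * g 0 + 0#) * h 0 + 0#   ≈⟨ +-congʳ (trans (*-congʳ (+-identityʳ _)) (*-assoc _ _ _)) ⟩
    f 0 * (g 0 * h 0) + 0#        ≈⟨ +-congʳ (*-congˡ (+-identityʳ _)) ⟨
    f 0 * (g 0 * h 0 + 0#) + 0#   ∎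
  -- The tail of `f S.* g` is by definition `f 0 * g (suc k) + (f′ S.* g) k`, so the induction
  -- hypothesis is applied to `f′`.
  ⋆-assoc f g h (suc n) = begin
    (f 0 * g 0 + 0#) * h (suc n) + ((λ k → f 0 * g (suc k) + (f′ S.* g) k) S.* h) n
      ≈⟨ +-cong (trans (*-congʳ (+-identityʳ _)) (*-assoc _ _ _))
           (trans (⋆-distribʳ h (λ k → f 0 * g (suc k)) (f′ S.* g) n)
             (+-cong (⋆-scaleˡ (f 0) (g ∘ suc) h n) (⋆-assoc f′ g h n))) ⟩
    f 0 * (g 0 * h (suc n)) + (f 0 * ((g ∘ suc) S.* h) n + (f′ S.* (g S.* h)) n)
      ≈⟨ +-assoc _ _ _ ⟨
    f 0 * (g 0 * h (suc n)) + f 0 * ((g ∘ suc) S.* h) n + (f′ S.* (g S.* h)) n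
      ≈⟨ +-congʳ (distribˡ _ _ _) ⟨
    f 0 * (g S.* h) (suc n) + (f′ S.* (g S.* h)) n ∎
    where f′ = f ∘ suc

  ⋆-constantˡ : ∀ a f n → (P.constant a S.* f) n ≈ a * f n
  ⋆-constantˡ a f zero    = +-identityʳ _
  ⋆-constantˡ a f (suc n) = trans (+-congˡ (⋆-zeroˡ (P.constant a ∘ suc) f (λ _ → refl) n)) (+-identityʳ _)

  ⋆-X-suc : ∀ f n → (P.X S.* f) (suc n) ≈ f n
  ⋆-X-suc f n = begin
    0# * f (suc n) + ((P.X ∘ suc) S.* f) n ≈⟨ +-cong (zeroˡ _) (⋆-cong (P.X ∘ suc) (P.constant 1#) f f X∘suc (λ _ → refl) n) ⟩
    0# + (P.constant 1# S.* f) n           ≈⟨ +-identityˡ _ ⟩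
    (P.constant 1# S.* f) n                ≈⟨ ⋆-constantˡ 1# f n ⟩
    1# * f n                               ≈⟨ *-identityˡ _ ⟩
    f n                                    ∎
    where
    X∘suc : (P.X ∘ suc) S.≈ P.constant 1#
    X∘suc zero    = refl
    X∘suc (suc n) = refl

  ⋆-X-zero : ∀ f → (P.X S.* f) 0 ≈ 0#
  ⋆-X-zero f = trans (+-identityʳ _) (zeroˡ _)

  ⋆-identityˡ : ∀ f → S.1# S.* f S.≈ f
  ⋆-identityˡ f n = trans (⋆-constantˡ 1# f n) (*-identityˡ _)

  commutativeRing : CommutativeRing c ℓ
  commutativeRing = record
    { RawRing P.rawRing
    ; isCommutativeRing = record
      { isRing = record
        { +-isAbelianGroup = record
          { isGroup = record
            { isMonoid = record
              { isSemigroup = record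
                { isMagma = record
                  { isEquivalence = record
                    { refl  = λ _ → refl
                    ; sym   = λ p n → sym (p n)
                    ; trans = λ p q n → trans (p n) (q n)
                    }
                  ; ∙-cong = λ p q n → +-cong (p n) (q n)
                  }
                ; assoc = λ f g h n → +-assoc _ _ _
                }
              ; identity = (λ f n → +-identityˡ _) , (λ f n → +-identityʳ _)
              }
            ; inverse = (λ f n → -‿inverseˡ _) , (λ f n → -‿inverseʳ _)
            ; ⁻¹-cong = λ p n → -‿cong (p n)
            }
          ; comm = λ f g n → +-comm _ _
          }
        ; *-cong = λ {f} {f′} {g} {g′} → ⋆-cong f f′ g g′
        ; *-assoc = ⋆-assoc
        ; *-identity = ⋆-identityˡ , λ f n → trans (⋆-comm f S.1# n) (⋆-identityˡ f n)
        ; distrib = (λ h f g n → trans (⋆-comm h (f S.+ g) n)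
                      (trans (⋆-distribʳ h f g n) (+-cong (⋆-comm f h n) (⋆-comm g h n))))
                    , ⋆-distribʳ
        }
      ; *-comm = ⋆-comm
      }
    }

  sum-coefficient : ∀ {k} (t : Fin k → Series) n →
    FiniteSums.sum commutativeRing t n ≈ sum (λ j → t j n)
  sum-coefficient {zero}  t n = refl
  sum-coefficient {suc k} t n = +-congˡ (sum-coefficient (t ∘ suc) n)

  module _ (h : Series) (h₀≈1 : h 0 ≈ 1#) where

    private
      u : Series
      u = S.1# S.+ S.- h

      -- Partial sums of the geometric series for 1/(1 - u), where 1 - u = h.
      approximation : ℕ → Series
      approximation zero    = S.1#
      approximation (suc k) = S.1# S.+ u S.* approximation k

      -- The diagonal takes coefficient n at the stage from which on it no longer changes, so no
      -- notion of limit is involved.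
      inverse : Series
      inverse n = approximation n n

      u₀≈0 : u 0 ≈ 0#
      u₀≈0 = trans (+-congˡ (-‿cong h₀≈1)) (-‿inverseʳ 1#)

      -- This holds because u has no constant term.
      u⋆-local : ∀ n (g g′ : Series) → (∀ b → b ℕ.< n → g b ≈ g′ b) →
                 (u S.* g) n ≈ (u S.* g′) n
      u⋆-local n g g′ eq = ⋆-local u u g g′ n λ where
        zero    b _  → trans (*-congʳ u₀≈0) (trans (zeroˡ _)
                         (sym (trans (*-congʳ u₀≈0) (zeroˡ _))))
        (suc a) b eq′ → *-congˡ (eq b (≡.subst (b ℕ.<_) eq′ (ℕ.s≤s (ℕ.m≤n+m b a))))

      stable : ∀ k l n → n ℕ.≤ k → n ℕ.≤ l → approximation k n ≈ approximation l n
      stable zero    zero    n       n≤k n≤l = refl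
      stable zero    (suc l) zero    n≤k n≤l = sym (trans (+-congˡ (trans (+-identityʳ _)
        (trans (*-congʳ u₀≈0) (zeroˡ _)))) (+-identityʳ _))
      stable (suc k) zero    zero    n≤k n≤l = trans (+-congˡ (trans (+-identityʳ _)
        (trans (*-congʳ u₀≈0) (zeroˡ _)))) (+-identityʳ _)
      stable (suc k) (suc l) n n≤k n≤l = +-congˡ (u⋆-local n (approximation k) (approximation l) λ b b<n →
        stable k l b (ℕ.≤-pred (ℕ.≤-trans b<n n≤k)) (ℕ.≤-pred (ℕ.≤-trans b<n n≤l)))

      inverse≈1+u⋆inverse : inverse S.≈ S.1# S.+ u S.* inverse
      inverse≈1+u⋆inverse n = begin
        approximation n n          ≈⟨ stable n (suc n) n ℕ.≤-refl (ℕ.n≤1+n n) ⟩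
        approximation (suc n) n    ≈⟨ +-congˡ (u⋆-local n (approximation n) inverse λ b b<n →
                                        stable n b b (ℕ.<⇒≤ b<n) ℕ.≤-refl) ⟩
        (S.1# S.+ u S.* inverse) n ∎

      -- Both sides agree after adding `u S.* inverse`: as u + h = 1, the left becomes `inverse`,
      -- and the fixed-point equation says the same of the right.
      inverse⋆h : h S.* inverse S.≈ S.1#
      inverse⋆h n = begin
        (h S.* inverse) n
          ≈⟨ +-identityˡ _ ⟨
        0# + (h S.* inverse) n
          ≈⟨ +-congʳ (-‿inverseˡ _) ⟨
        (- (u S.* inverse) n + (u S.* inverse) n) + (h S.* inverse) n
          ≈⟨ +-assoc _ _ _ ⟩
        - (u S.* inverse) n + ((u S.* inverse) n + (h S.* inverse) n)
          ≈⟨ +-congˡ (⋆-distribʳ inverse u h n) ⟨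
        - (u S.* inverse) n + ((u S.+ h) S.* inverse) n
          ≈⟨ +-congˡ (trans (⋆-cong (u S.+ h) S.1# inverse inverse u+h (λ _ → refl) n) (⋆-identityˡ inverse n)) ⟩
        - (u S.* inverse) n + inverse n
          ≈⟨ +-congˡ (trans (inverse≈1+u⋆inverse n) (+-comm _ _)) ⟩
        - (u S.* inverse) n + ((u S.* inverse) n + S.1# n)
          ≈⟨ +-assoc _ _ _ ⟨
        (- (u S.* inverse) n + (u S.* inverse) n) + S.1# n
          ≈⟨ +-congʳ (-‿inverseˡ _) ⟩
        0# + S.1# n
          ≈⟨ +-identityˡ _ ⟩
        S.1# n ∎
        where
        u+h : u S.+ h S.≈ S.1#
        u+h n = trans (+-assoc _ _ _) (trans (+-congˡ (-‿inverseˡ _)) (+-identityʳ _))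

    invertible : ∃ λ g → (g S.* h S.≈ S.1#) × (h S.* g S.≈ S.1#)
    invertible = inverse , (λ n → trans (⋆-comm inverse h n) (inverse⋆h n)) , inverse⋆h

-- Derivatives of power series and the product rule

module Derivation {c ℓ} (R : CommutativeRing c ℓ) where
  open CommutativeRing R hiding (zero)
  open PowerSeriesRing R
  open import Algebra.Properties.Semiring.Mult semiring
    using (×-comm-*; ×-assoc-*) renaming (_×_ to _·_)
  open import Algebra.Properties.CommutativeMonoid.Mult +-commutativeMonoid using (×-distrib-+)
  open import Relation.Binary.Reasoning.Setoid setoid

  private
    module S = RawRing (PowerSeries.rawRing rawRing)

    Series : Set c
    Series = ℕ → Carrier

  -- The Euler operator t d/dt. It preserves degrees, which suits an induction on the degree, and
  -- `D f n` is `θ f (suc n)` by definition.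
  θ : Series → Series
  θ f n = n · f n

  D : Series → Series
  D f n = suc n · f (suc n)

  θ-⋆ : ∀ f g n → θ (f S.* g) n ≈ (θ f S.* g) n + (f S.* θ g) n
  θ-⋆ f g zero = sym (begin
    0# * g 0 + 0# + (f 0 * 0# + 0#) ≈⟨ +-cong (trans (+-identityʳ _) (zeroˡ _))
                                              (trans (+-identityʳ _) (zeroʳ _)) ⟩
    0# + 0#                         ≈⟨ +-identityʳ _ ⟩
    0#                              ∎)
  θ-⋆ f g (suc n) = sym (begin
    (0# * g (suc n) + ((θ f ∘ suc) S.* g) n) + (f 0 * (suc n · g (suc n)) + (f′ S.* θ g) n)
      -- By definition `θ f ∘ suc` is `f′ S.+ θ f′`.
      ≈⟨ +-cong (trans (+-congʳ (zeroˡ _)) (trans (+-identityˡ _) (⋆-distribʳ g f′ (θ f′) n)))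
                (+-congʳ (×-comm-* (suc n) (f 0) (g (suc n)))) ⟩
    ((f′ S.* g) n + (θ f′ S.* g) n) + (suc n · (f 0 * g (suc n)) + (f′ S.* θ g) n)
      ≈⟨ +-congˡ (+-comm _ _) ⟩
    ((f′ S.* g) n + (θ f′ S.* g) n) + ((f′ S.* θ g) n + suc n · (f 0 * g (suc n)))
      ≈⟨ +-assoc _ _ _ ⟨
    ((f′ S.* g) n + (θ f′ S.* g) n) + (f′ S.* θ g) n + suc n · (f 0 * g (suc n))
      ≈⟨ +-congʳ (trans (+-assoc _ _ _) (+-congˡ (sym (θ-⋆ f′ g n)))) ⟩
    suc n · (f′ S.* g) n + suc n · (f 0 * g (suc n))
      ≈⟨ +-comm _ _ ⟩
    suc n · (f 0 * g (suc n)) + suc n · (f′ S.* g) n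
      ≈⟨ ×-distrib-+ _ _ (suc n) ⟨
    suc n · (f S.* g) (suc n) ∎)
    where f′ = f ∘ suc

  D-⋆ : ∀ f g n → D (f S.* g) n ≈ (D f S.* g) n + (f S.* D g) n
  D-⋆ f g n = begin
    θ (f S.* g) (suc n)
      ≈⟨ θ-⋆ f g (suc n) ⟩
    (θ f S.* g) (suc n) + (f S.* θ g) (suc n)
      ≈⟨ +-cong (trans (+-congʳ (zeroˡ _)) (+-identityˡ _))
                (trans (⋆-sucʳ f (θ g) n) (trans (+-congˡ (zeroʳ _)) (+-identityʳ _))) ⟩
    (D f S.* g) n + (f S.* D g) n ∎

-- Exponential generating functions in two variables

module DividedPowers {c ℓ} (R : CommutativeRing c ℓ) (e : ℕ → CommutativeRing.Carrier R) where
  open CommutativeRing R hiding (zero)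
  open PowerSeriesRing R
  open Derivation R
  open import Algebra.Properties.Semiring.Mult semiring
    using (×-comm-*; ×-assoc-*; ×-homo-+) renaming (_×_ to _·_)
  open import Relation.Binary.Reasoning.Setoid setoid

  private
    module S  = RawRing (PowerSeries.rawRing rawRing)
    module S₂ = RawRing (PowerSeries.rawRing (PowerSeries.rawRing rawRing))
    module PS₂ = PowerSeriesRing commutativeRing

  -- The model is e n = 1/n!. It enters through its recurrence, and division by n + 1 takes the form
  -- of cancelling a multiple.
  module _ (e-zero : e 0 ≈ 1#) (e-suc : ∀ n → suc n · e (suc n) ≈ e n)
           (×-cancelˡ : ∀ n {a b} → suc n · a ≈ suc n · b → a ≈ b) where

    -- With u a = Σ_b c(a,b) e_b t^b and v a = Σ_b c(a+b,0) e_b t^b, the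
    -- recurrence says D (u a) = u (a + 1) + u a; the right-hand sides
    -- e · v a satisfy the same equations, as D (v a) = v (a + 1).
    array-solution : (c : ℕ → ℕ → Carrier) →
      (∀ a b → c a (suc b) ≈ c (suc a) b + c a b) →
      ∀ b a → c a b * e b ≈ (e S.* (λ k → c (a ℕ.+ k) 0 * e k)) b
    array-solution c c-suc = solution
      where
      u v : ℕ → ℕ → Carrier
      u a b = c a b * e b
      v a b = c (a ℕ.+ b) 0 * e b

      D-e* : ∀ x n → suc n · (x * e (suc n)) ≈ x * e n
      D-e* x n = trans (sym (×-comm-* (suc n) x _)) (*-congˡ (e-suc n))

      D-v : ∀ a n → D (v a) n ≈ v (suc a) n
      D-v a n = trans (D-e* _ n) (*-congʳ (reflexive (≡.cong (λ k → c k 0) (ℕ.+-suc a n))))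

      -- The induction on b keeps a general, because the recurrence trades b + 1 for a + 1.
      solution : ∀ b a → u a b ≈ (e S.* v a) b
      solution zero a = begin
        c a 0 * e 0                    ≈⟨ *-comm _ _ ⟩
        e 0 * c a 0                    ≈⟨ *-congˡ (*-identityʳ _) ⟨
        e 0 * (c a 0 * 1#)             ≈⟨ *-congˡ (*-cong
          (reflexive (≡.cong (λ k → c k 0) (≡.sym (ℕ.+-identityʳ a)))) (sym e-zero)) ⟩
        e 0 * (c (a ℕ.+ 0) 0 * e 0)    ≈⟨ +-identityʳ _ ⟨
        e 0 * v a 0 + 0#               ∎
      solution (suc n) a = ×-cancelˡ n (begin
        suc n · u a (suc n)
          ≈⟨ D-e* _ n ⟩
        c a (suc n) * e n
          ≈⟨ trans (*-congʳ (c-suc a n)) (distribʳ _ _ _) ⟩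
        u (suc a) n + u a n
          ≈⟨ +-cong (solution n (suc a)) (solution n a) ⟩
        (e S.* v (suc a)) n + (e S.* v a) n
          ≈⟨ +-comm _ _ ⟩
        (e S.* v a) n + (e S.* v (suc a)) n
          ≈⟨ +-cong (⋆-cong (D e) e (v a) (v a) e-suc (λ _ → refl) n)
               (⋆-cong e e (D (v a)) (v (suc a)) (λ _ → refl) (D-v a) n) ⟨
        (D e S.* v a) n + (e S.* D (v a)) n
          ≈⟨ D-⋆ e (v a) n ⟨
        suc n · (e S.* v a) (suc n) ∎)

    private
      open import Algebra.Definitions.RawSemiring S₂.rawSemiring using (_^_)

      X₁ X₂ : S₂.Carrier
      X₁ = PowerSeries.X (PowerSeries.rawRing rawRing)
      X₂ = PowerSeries.constant (PowerSeries.rawRing rawRing) (PowerSeries.X rawRing)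

      w : ℕ → S₂.Carrier
      w n = (X₁ S₂.+ X₂) ^ n

      w-suc : ∀ n a b → w (suc n) a b ≈ (X₁ S₂.* w n) a b + (PowerSeries.X rawRing S.* w n a) b
      w-suc n a b = trans (PS₂.⋆-distribʳ (w n) X₁ X₂ a b)
                      (+-congˡ (PS₂.⋆-constantˡ (PowerSeries.X rawRing) (w n) a b))

    -- Multiplication by x + y raises the total degree by one, so the n-th power is homogeneous of
    -- degree n.
    power-off : ∀ n a b → a ℕ.+ b ≢ n → w n a b ≈ 0#
    power-off zero    zero    zero    a+b≢n = ⊥-elim (a+b≢n ≡.refl)
    power-off zero    zero    (suc b) a+b≢n = refl
    power-off zero    (suc a) b       a+b≢n = refl
    power-off (suc n) a b a+b≢n = begin
      w (suc n) a b
        ≈⟨ w-suc n a b ⟩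
      (X₁ S₂.* w n) a b + (PowerSeries.X rawRing S.* w n a) b
        ≈⟨ +-cong (first a b a+b≢n) (second b a+b≢n) ⟩
      0# + 0#
        ≈⟨ +-identityʳ _ ⟩
      0# ∎
      where
      first : ∀ a b → a ℕ.+ b ≢ suc n → (X₁ S₂.* w n) a b ≈ 0#
      first zero    b neq = PS₂.⋆-X-zero (w n) b
      first (suc a) b neq = trans (PS₂.⋆-X-suc (w n) a b) (power-off n a b (neq ∘ ≡.cong suc))
      second : ∀ b → a ℕ.+ b ≢ suc n → (PowerSeries.X rawRing S.* w n a) b ≈ 0#
      second zero    neq = ⋆-X-zero (w n a)
      second (suc b) neq = trans (⋆-X-suc (w n a) b)
        (power-off n a b (neq ∘ λ eq → ≡.trans (ℕ.+-suc a b) (≡.cong suc eq)))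

    -- The binomial theorem in the form (x + y)^n / n! = sum of x^a/a! y^b/b! over a + b = n. After
    -- multiplication by n + 1 = a + b, the factor x accounts for the multiple a and the factor y
    -- for the multiple b.
    power-on : ∀ n a b → a ℕ.+ b ≡ n → e n * w n a b ≈ e a * e b
    power-on zero    zero zero ≡.refl = *-congˡ (sym e-zero)
    power-on (suc n) a b a+b≡n = ×-cancelˡ n (begin
      suc n · (e (suc n) * w (suc n) a b)
        ≈⟨ trans (sym (×-assoc-* (suc n) _ _)) (*-cong (e-suc n) (w-suc n a b)) ⟩
      e n * ((X₁ S₂.* w n) a b + (PowerSeries.X rawRing S.* w n a) b)
        ≈⟨ trans (distribˡ _ _ _) (+-cong (first a b a+b≡n) (second b a+b≡n)) ⟩
      a · (e a * e b) + b · (e a * e b)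
        ≈⟨ ×-homo-+ (e a * e b) a b ⟨
      (a ℕ.+ b) · (e a * e b)
        ≡⟨ ≡.cong (_· (e a * e b)) a+b≡n ⟩
      suc n · (e a * e b) ∎)
      where
      first : ∀ a b → a ℕ.+ b ≡ suc n → e n * (X₁ S₂.* w n) a b ≈ a · (e a * e b)
      first zero    b eq = trans (*-congˡ (PS₂.⋆-X-zero (w n) b)) (zeroʳ _)
      first (suc a) b eq = begin
        e n * (X₁ S₂.* w n) (suc a) b ≈⟨ *-congˡ (PS₂.⋆-X-suc (w n) a b) ⟩
        e n * w n a b                 ≈⟨ power-on n a b (ℕ.suc-injective eq) ⟩
        e a * e b                     ≈⟨ *-congʳ (e-suc a) ⟨
        (suc a · e (suc a)) * e b     ≈⟨ ×-assoc-* (suc a) _ _ ⟩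
        suc a · (e (suc a) * e b)     ∎
      second : ∀ b → a ℕ.+ b ≡ suc n →
               e n * (PowerSeries.X rawRing S.* w n a) b ≈ b · (e a * e b)
      second zero    eq = trans (*-congˡ (⋆-X-zero (w n a))) (zeroʳ _)
      second (suc b) eq = begin
        e n * (PowerSeries.X rawRing S.* w n a) (suc b) ≈⟨ *-congˡ (⋆-X-suc (w n a) b) ⟩
        e n * w n a b             ≈⟨ power-on n a b (ℕ.suc-injective (≡.trans (≡.sym (ℕ.+-suc a b)) eq)) ⟩
        e a * e b                 ≈⟨ *-congˡ (e-suc b) ⟨
        e a * (suc b · e (suc b)) ≈⟨ ×-comm-* (suc b) _ _ ⟩
        suc b · (e a * e (suc b)) ∎

-- Determinants

-- Deleting column j leaves two adjacent columns adjacent unless j is one of them; this lets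
-- `det-adjacent` recurse into minors.
punchIn-adjacent : ∀ {n} (j : Fin (suc (suc n))) (q : Fin (suc n)) →
  j ≡ inject₁ q ⊎ j ≡ suc q ⊎
  ∃ λ q′ → punchIn j (inject₁ q′) ≡ inject₁ q × punchIn j (suc q′) ≡ suc q
punchIn-adjacent zero          zero    = inj₁ ≡.refl
punchIn-adjacent {suc n} zero  (suc q) = inj₂ (inj₂ (q , ≡.refl , ≡.refl))
punchIn-adjacent (suc zero)    zero    = inj₂ (inj₁ ≡.refl)
punchIn-adjacent {suc n} (suc (suc j)) zero = inj₂ (inj₂ (zero , ≡.refl , ≡.refl))
punchIn-adjacent {suc n} (suc j) (suc q) with punchIn-adjacent j q
... | inj₁ eq                   = inj₁ (≡.cong suc eq)
... | inj₂ (inj₁ eq)            = inj₂ (inj₁ (≡.cong suc eq))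
... | inj₂ (inj₂ (q′ , eq , eq′)) = inj₂ (inj₂ (suc q′ , ≡.cong suc eq , ≡.cong suc eq′))

-- Deleting either of two adjacent columns moves the survivor to the same index, so the two minors
-- coincide when these columns are equal.
punchIn-inject₁-suc : ∀ {n} (q : Fin (suc n)) (l : Fin (suc n)) →
  punchIn (inject₁ q) l ≡ punchIn (suc q) l ⊎
  (punchIn (inject₁ q) l ≡ suc q × punchIn (suc q) l ≡ inject₁ q)
punchIn-inject₁-suc zero    zero    = inj₂ (≡.refl , ≡.refl)
punchIn-inject₁-suc zero    (suc l) = inj₁ ≡.refl
punchIn-inject₁-suc (suc q) zero    = inj₁ ≡.refl
punchIn-inject₁-suc {suc n} (suc q) (suc l) with punchIn-inject₁-suc q l
... | inj₁ eq         = inj₁ (≡.cong suc eq)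
... | inj₂ (eq , eq′) = inj₂ (≡.cong suc eq , ≡.cong suc eq′)

inject₁≢suc : ∀ {n} (q : Fin n) → inject₁ q ≢ suc q
inject₁≢suc q eq = ℕ.1+n≢n (≡.sym (≡.trans (≡.sym (Fin.toℕ-inject₁ q)) (≡.cong toℕ eq)))

module DeterminantProperties {c ℓ} (R : CommutativeRing c ℓ) where
  open CommutativeRing R hiding (zero)
  open FiniteSums R
  open Determinant rawRing renaming (det to determinant)
  open import Algebra.Definitions.RawSemiring (RawRing.rawSemiring rawRing) using (_^_)
  open import Algebra.Properties.Ring ring using (-1*x≈-x)
  open import Algebra.Properties.CommutativeSemigroup *-commutativeSemigroup
    using (x∙yz≈y∙xz)
  open import Relation.Binary.Reasoning.Setoid setoid

  Matrix : ℕ → Set c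
  Matrix n = Fin n → Fin n → Carrier

  sgn : ∀ {n} → Fin n → Carrier
  sgn j = (- 1#) ^ toℕ j

  minor : ∀ {n} → Matrix (suc n) → Fin (suc n) → Matrix n
  minor A j k l = A (suc k) (punchIn j l)

  expansion : ∀ {n} → Matrix (suc n) → Fin (suc n) → Carrier
  expansion A j = sgn j * (A zero j * determinant (minor A j))

  det-cong : ∀ {n} (A B : Matrix n) → (∀ k l → A k l ≈ B k l) → determinant A ≈ determinant B
  det-cong {zero}  A B A≈B = refl
  det-cong {suc n} A B A≈B = sum-cong (expansion A) (expansion B) λ j →
    *-congˡ (*-cong (A≈B zero j)
      (det-cong (minor A j) (minor B j) λ k l → A≈B (suc k) (punchIn j l)))

  -- In the expansion, the term j = q meets column q in its first-row entry, every other term in its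
  -- minor. The hypotheses compare entries, so that they pass to minors; the coefficients 1, 1 and
  -- 0, 0 give additivity and the case of a zero column.
  det-linear : ∀ {n} (q : Fin n) (a b : Carrier) (A B C : Matrix n) →
    (∀ k → A k q ≈ a * B k q + b * C k q) →
    (∀ k l → l ≢ q → A k l ≈ B k l) → (∀ k l → l ≢ q → A k l ≈ C k l) →
    determinant A ≈ a * determinant B + b * determinant C
  det-linear {suc n} q a b A B C at-q A≈B A≈C = begin
    sum (expansion A)
      ≈⟨ sum-cong (expansion A) (λ j → a * expansion B j + b * expansion C j) expansion-linear ⟩
    sum (λ j → a * expansion B j + b * expansion C j)
      ≈⟨ ∑-distrib-+ (λ j → a * expansion B j) (λ j → b * expansion C j) ⟩
    sum (λ j → a * expansion B j) + sum (λ j → b * expansion C j)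
      ≈⟨ +-cong (*-distribˡ-sum a (expansion B)) (*-distribˡ-sum b (expansion C)) ⟨
    a * sum (expansion B) + b * sum (expansion C) ∎
    where
    reassociate : ∀ s x y u → s * (x * (y * u)) ≈ y * (s * (x * u))
    reassociate s x y u = trans (*-congˡ (x∙yz≈y∙xz x y u)) (x∙yz≈y∙xz s y (x * u))

    collect : ∀ s x u v → s * (x * (a * u + b * v)) ≈ a * (s * (x * u)) + b * (s * (x * v))
    collect s x u v = trans (*-congˡ (distribˡ x _ _)) (trans (distribˡ s _ _)
      (+-cong (reassociate s x a u) (reassociate s x b v)))

    collect′ : ∀ s x y u → s * ((a * x + b * y) * u) ≈ a * (s * (x * u)) + b * (s * (y * u))
    collect′ s x y u = trans (*-congˡ (*-comm _ u)) (trans (collect s u x y)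
      (+-cong (*-congˡ (*-congˡ (*-comm u x))) (*-congˡ (*-congˡ (*-comm u y)))))

    expansion-linear : ∀ j → expansion A j ≈ a * expansion B j + b * expansion C j
    expansion-linear j with j Fin.≟ q
    ... | yes ≡.refl = begin
      sgn j * (A zero j * determinant (minor A j))
        ≈⟨ *-congˡ (*-congʳ (at-q zero)) ⟩
      sgn j * ((a * B zero j + b * C zero j) * determinant (minor A j))
        ≈⟨ collect′ _ _ _ _ ⟩
      a * (sgn j * (B zero j * determinant (minor A j))) + b * (sgn j * (C zero j * determinant (minor A j)))
        ≈⟨ +-cong
             (*-congˡ (*-congˡ (*-congˡ (det-cong (minor A j) (minor B j) λ k l →
               A≈B (suc k) _ (Fin.punchInᵢ≢i j l)))))
             (*-congˡ (*-congˡ (*-congˡ (det-cong (minor A j) (minor C j) λ k l →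
               A≈C (suc k) _ (Fin.punchInᵢ≢i j l))))) ⟩
      a * expansion B j + b * expansion C j ∎
    ... | no j≢q = begin
      sgn j * (A zero j * determinant (minor A j))
        ≈⟨ *-congˡ (*-congˡ (det-linear q′ a b (minor A j) (minor B j) (minor C j)
             (λ k → ≡.subst (λ l → A (suc k) l ≈ a * B (suc k) l + b * C (suc k) l)
                      (≡.sym punchIn-q′) (at-q (suc k)))
             (λ k l l≢q′ → A≈B (suc k) _ (l≢q′ ∘ off-q′))
             (λ k l l≢q′ → A≈C (suc k) _ (l≢q′ ∘ off-q′)))) ⟩
      sgn j * (A zero j * (a * determinant (minor B j) + b * determinant (minor C j)))
        ≈⟨ collect _ _ _ _ ⟩
      a * (sgn j * (A zero j * determinant (minor B j))) + b * (sgn j * (A zero j * determinant (minor C j)))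
        ≈⟨ +-cong (*-congˡ (*-congˡ (*-congʳ (A≈B zero j j≢q))))
                  (*-congˡ (*-congˡ (*-congʳ (A≈C zero j j≢q)))) ⟩
      a * expansion B j + b * expansion C j ∎
      -- The position of column q inside the minor without column j.
      where
      q′ = punchOut j≢q
      punchIn-q′ : punchIn j q′ ≡ q
      punchIn-q′ = Fin.punchIn-punchOut j≢q
      off-q′ : ∀ {l} → punchIn j l ≡ q → l ≡ q′
      off-q′ eq = Fin.punchIn-injective j _ _ (≡.trans eq (≡.sym punchIn-q′))

  det-additive : ∀ {n} (q : Fin n) (A B C : Matrix n) →
    (∀ k → A k q ≈ B k q + C k q) →
    (∀ k l → l ≢ q → A k l ≈ B k l) → (∀ k l → l ≢ q → A k l ≈ C k l) →
    determinant A ≈ determinant B + determinant C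
  det-additive q A B C at-q A≈B A≈C = trans
    (det-linear q 1# 1# A B C
      (λ k → trans (at-q k) (sym (+-cong (*-identityˡ _) (*-identityˡ _)))) A≈B A≈C)
    (+-cong (*-identityˡ _) (*-identityˡ _))

  det-zeroColumn : ∀ {n} (q : Fin n) (A : Matrix n) → (∀ k → A k q ≈ 0#) → determinant A ≈ 0#
  det-zeroColumn q A at-q = trans
    (det-linear q 0# 0# A A A
      (λ k → trans (at-q k) (sym (trans (+-cong (zeroˡ _) (zeroˡ _)) (+-identityʳ _))))
      (λ _ _ _ → refl) (λ _ _ _ → refl))
    (trans (+-cong (zeroˡ _) (zeroˡ _)) (+-identityʳ _))

  -- The terms deleting one of the two equal columns have the same minor and opposite signs; in all
  -- others the columns stay adjacent in the minor and induction applies. General equal columns are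
  -- reduced to this case by swaps.
  det-adjacent : ∀ {n} (q : Fin n) (A : Matrix (suc n)) →
    (∀ k → A k (inject₁ q) ≈ A k (suc q)) → determinant A ≈ 0#
  det-adjacent {suc n} q A equal = sum-adjacent q (expansion A) cancel other
    where
    cancel : expansion A (inject₁ q) + expansion A (suc q) ≈ 0#
    cancel = begin
      sgn (inject₁ q) * (A zero (inject₁ q) * determinant (minor A (inject₁ q))) + expansion A (suc q)
        ≈⟨ +-congʳ (*-cong (reflexive (≡.cong ((- 1#) ^_) (Fin.toℕ-inject₁ q)))
             (*-cong (equal zero) (det-cong (minor A (inject₁ q)) (minor A (suc q)) minors))) ⟩
      s * w + (- 1# * s) * w ≈⟨ +-congˡ (trans (*-assoc _ _ _) (-1*x≈-x _)) ⟩
      s * w + - (s * w)      ≈⟨ -‿inverseʳ _ ⟩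
      0#                     ∎
      where
      s = sgn q
      w = A zero (suc q) * determinant (minor A (suc q))
      minors : ∀ k l → minor A (inject₁ q) k l ≈ minor A (suc q) k l
      minors k l with punchIn-inject₁-suc q l
      ... | inj₁ eq         = reflexive (≡.cong (A (suc k)) eq)
      ... | inj₂ (eq , eq′) = begin
        A (suc k) (punchIn (inject₁ q) l) ≡⟨ ≡.cong (A (suc k)) eq ⟩
        A (suc k) (suc q)                 ≈⟨ equal (suc k) ⟨
        A (suc k) (inject₁ q)             ≡⟨ ≡.cong (A (suc k)) eq′ ⟨
        A (suc k) (punchIn (suc q) l)     ∎

    other : ∀ j → j ≢ inject₁ q → j ≢ suc q → expansion A j ≈ 0#
    other j j≢q j≢q+1 with punchIn-adjacent j q
    ... | inj₁ eq        = ⊥-elim (j≢q eq)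
    ... | inj₂ (inj₁ eq) = ⊥-elim (j≢q+1 eq)
    ... | inj₂ (inj₂ (q′ , eq , eq′)) = trans (*-congˡ (trans (*-congˡ
      (det-adjacent q′ (minor A j) λ k → begin
        A (suc k) (punchIn j (inject₁ q′)) ≡⟨ ≡.cong (A (suc k)) eq ⟩
        A (suc k) (inject₁ q)              ≈⟨ equal (suc k) ⟩
        A (suc k) (suc q)                  ≡⟨ ≡.cong (A (suc k)) eq′ ⟨
        A (suc k) (punchIn j (suc q′))     ∎)) (zeroʳ _))) (zeroʳ _)

  replaceColumn : ∀ {n} → Matrix n → Fin n → (Fin n → Carrier) → Matrix n
  replaceColumn A q v k = updateAt (A k) q (const (v k))

  replaceColumn-at : ∀ {n} (A : Matrix n) q v k → replaceColumn A q v k q ≈ v k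
  replaceColumn-at A q v k = reflexive (updateAt-updates q (A k))

  replaceColumn-off : ∀ {n} (A : Matrix n) q v k {l} → l ≢ q → replaceColumn A q v k l ≈ A k l
  replaceColumn-off A q v k {l} l≢q = reflexive (updateAt-minimal l q (A k) l≢q)

  det-replaceColumn-linear : ∀ {n} (A : Matrix n) q a b (u v w : Fin n → Carrier) →
    (∀ k → w k ≈ a * u k + b * v k) →
    determinant (replaceColumn A q w) ≈
      a * determinant (replaceColumn A q u) + b * determinant (replaceColumn A q v)
  det-replaceColumn-linear A q a b u v w eq =
    det-linear q a b (replaceColumn A q w) (replaceColumn A q u) (replaceColumn A q v)
      (λ k → trans (replaceColumn-at A q w k) (trans (eq k)
        (sym (+-cong (*-congˡ (replaceColumn-at A q u k)) (*-congˡ (replaceColumn-at A q v k))))))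
      (λ k l l≢q → trans (replaceColumn-off A q w k l≢q) (sym (replaceColumn-off A q u k l≢q)))
      (λ k l l≢q → trans (replaceColumn-off A q w k l≢q) (sym (replaceColumn-off A q v k l≢q)))

  det-replaceColumn-sum : ∀ {n m} (A : Matrix n) q (f : Fin m → Carrier)
    (v : Fin m → Fin n → Carrier) →
    determinant (replaceColumn A q (λ k → sum (λ j → f j * v j k))) ≈
      sum (λ j → f j * determinant (replaceColumn A q (v j)))
  det-replaceColumn-sum {m = zero} A q f v =
    det-zeroColumn q (replaceColumn A q (λ _ → 0#)) (replaceColumn-at A q (λ _ → 0#))
  det-replaceColumn-sum {m = suc m} A q f v = begin
    determinant (replaceColumn A q (λ k → f zero * v zero k + rest k))
      ≈⟨ det-replaceColumn-linear A q (f zero) 1# (v zero) rest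
           (λ k → f zero * v zero k + rest k) (λ k → +-congˡ (sym (*-identityˡ _))) ⟩
    f zero * determinant (replaceColumn A q (v zero)) + 1# * determinant (replaceColumn A q rest)
      ≈⟨ +-congˡ (trans (*-identityˡ _) (det-replaceColumn-sum A q (f ∘ suc) (v ∘ suc))) ⟩
    sum (λ j → f j * determinant (replaceColumn A q (v j))) ∎
    where
    rest : Fin _ → Carrier
    rest k = sum (λ j → f (suc j) * v (suc j) k)

  -- Polarisation: put u + v into both columns. The determinant vanishes and expands into four
  -- terms, two of which vanish as well.
  det-swap : ∀ {n} (q : Fin n) (A B : Matrix (suc n)) →
    (∀ k → B k (inject₁ q) ≈ A k (suc q)) → (∀ k → B k (suc q) ≈ A k (inject₁ q)) →
    (∀ k l → l ≢ inject₁ q → l ≢ suc q → B k l ≈ A k l) →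
    determinant A + determinant B ≈ 0#
  det-swap {n} q A B B-q B-q+1 B-off = begin
    determinant A + determinant B
      ≈⟨ +-cong (det-cong A (N u v) A≈N) (det-cong B (N v u) B≈N) ⟩
    D u v + D v u
      ≈⟨ +-cong (trans (+-congʳ (D-equal u)) (+-identityˡ _))
           (trans (+-congˡ (D-equal v)) (+-identityʳ _)) ⟨
    (D u u + D u v) + (D v u + D v v)
      ≈⟨ +-cong (D-additiveʳ u) (D-additiveʳ v) ⟨
    D u u+v + D v u+v
      ≈⟨ D-additiveˡ ⟨
    D u+v u+v
      ≈⟨ D-equal u+v ⟩
    0# ∎
    where
    i = inject₁ q
    i≢q+1 : i ≢ suc q
    i≢q+1 = inject₁≢suc q

    u v u+v : Fin (suc n) → Carrier
    u k = A k i
    v k = A k (suc q)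
    u+v k = u k + v k

    N : (w w′ : Fin (suc n) → Carrier) → Matrix (suc n)
    N w w′ = replaceColumn (replaceColumn A i w) (suc q) w′

    D : (w w′ : Fin (suc n) → Carrier) → Carrier
    D w w′ = determinant (N w w′)

    N-q+1 : ∀ w w′ k → N w w′ k (suc q) ≈ w′ k
    N-q+1 w w′ k = replaceColumn-at (replaceColumn A i w) (suc q) w′ k

    N-q : ∀ w w′ k → N w w′ k i ≈ w k
    N-q w w′ k = trans (replaceColumn-off (replaceColumn A i w) (suc q) w′ k i≢q+1)
                   (replaceColumn-at A i w k)

    N-off : ∀ w w′ k {l} → l ≢ i → l ≢ suc q → N w w′ k l ≈ A k l
    N-off w w′ k l≢q l≢q+1 = trans (replaceColumn-off (replaceColumn A i w) (suc q) w′ k l≢q+1)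
                               (replaceColumn-off A i w k l≢q)

    D-equal : ∀ w → D w w ≈ 0#
    D-equal w = det-adjacent q (N w w) λ k → trans (N-q w w k) (sym (N-q+1 w w k))

    D-additiveʳ : ∀ w → D w u+v ≈ D w u + D w v
    D-additiveʳ w = det-additive (suc q) (N w u+v) (N w u) (N w v)
      (λ k → trans (N-q+1 w u+v k) (sym (+-cong (N-q+1 w u k) (N-q+1 w v k))))
      (same u) (same v)
      where
      same : ∀ w′ k l → l ≢ suc q → N w u+v k l ≈ N w w′ k l
      same w′ k l l≢q+1 = trans (replaceColumn-off (replaceColumn A i w) (suc q) u+v k l≢q+1)
        (sym (replaceColumn-off (replaceColumn A i w) (suc q) w′ k l≢q+1))

    D-additiveˡ : D u+v u+v ≈ D u u+v + D v u+v
    D-additiveˡ = det-additive i (N u+v u+v) (N u u+v) (N v u+v)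
      (λ k → trans (N-q u+v u+v k) (sym (+-cong (N-q u u+v k) (N-q v u+v k))))
      (same u) (same v)
      where
      same : ∀ w k l → l ≢ i → N u+v u+v k l ≈ N w u+v k l
      same w k l l≢q with l Fin.≟ suc q
      ... | yes ≡.refl  = trans (N-q+1 u+v u+v k) (sym (N-q+1 w u+v k))
      ... | no l≢q+1 = trans (N-off u+v u+v k l≢q l≢q+1) (sym (N-off w u+v k l≢q l≢q+1))

    A≈N : ∀ k l → A k l ≈ N u v k l
    A≈N k l with l Fin.≟ i | l Fin.≟ suc q
    ... | yes ≡.refl | _       = sym (N-q u v k)
    ... | no _    | yes ≡.refl = sym (N-q+1 u v k)
    ... | no l≢q  | no l≢q+1   = sym (N-off u v k l≢q l≢q+1)

    B≈N : ∀ k l → B k l ≈ N v u k l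
    B≈N k l with l Fin.≟ i | l Fin.≟ suc q
    ... | yes ≡.refl | _       = trans (B-q k) (sym (N-q v u k))
    ... | no _    | yes ≡.refl = trans (B-q+1 k) (sym (N-q+1 v u k))
    ... | no l≢q  | no l≢q+1   = trans (B-off k l l≢q l≢q+1) (sym (N-off v u k l≢q l≢q+1))

  -- Swapping column q with its left neighbour brings the two equal columns closer until they are
  -- adjacent. The number d is the termination measure, since `inject₁ q` is not a structural part
  -- of `suc q`.
  det-equalColumns : ∀ {n} d (p q : Fin n) → toℕ q ≡ d → p Fin.< q →
    (A : Matrix n) → (∀ k → A k p ≈ A k q) → determinant A ≈ 0#
  det-equalColumns {suc n} (suc d) p (suc q) q≡d p<q A equal with p Fin.≟ inject₁ q
  ... | yes ≡.refl = det-adjacent q A equal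
  ... | no p≢q  = begin
    determinant A                 ≈⟨ +-identityʳ _ ⟨
    determinant A + 0#            ≈⟨ +-congˡ (det-equalColumns d p i
                                       (≡.trans (Fin.toℕ-inject₁ q) (ℕ.suc-injective q≡d)) p<i B
                                       (λ k → trans (B-off k p p≢q (Fin.<⇒≢ p<q))
                                                (trans (equal k) (sym (B-q k))))) ⟨
    determinant A + determinant B ≈⟨ det-swap q A B B-q B-q+1 B-off ⟩
    0#                            ∎
    where
    i = inject₁ q
    u v : Fin (suc n) → Carrier
    u k = A k i
    v k = A k (suc q)

    A′ B : Matrix (suc n)
    A′ = replaceColumn A i v
    B = replaceColumn A′ (suc q) u

    B-q : ∀ k → B k i ≈ A k (suc q)
    B-q k = trans (replaceColumn-off A′ (suc q) u k (inject₁≢suc q)) (replaceColumn-at A i v k)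

    B-q+1 : ∀ k → B k (suc q) ≈ A k i
    B-q+1 k = replaceColumn-at A′ (suc q) u k

    B-off : ∀ k l → l ≢ i → l ≢ suc q → B k l ≈ A k l
    B-off k l l≢q l≢q+1 = trans (replaceColumn-off A′ (suc q) u k l≢q+1)
                            (replaceColumn-off A i v k l≢q)

    p<i : p Fin.< i
    p<i = Fin.≤∧≢⇒< (≡.subst (toℕ p ℕ.≤_) (≡.sym (Fin.toℕ-inject₁ q)) (ℕ.≤-pred p<q)) p≢q

  det-alternating : ∀ {n} {p q : Fin n} → p ≢ q →
    (A : Matrix n) → (∀ k → A k p ≈ A k q) → determinant A ≈ 0#
  det-alternating {p = p} {q} p≢q A equal with Fin.<-cmp p q
  ... | tri< p<q _ _ = det-equalColumns (toℕ q) p q ≡.refl p<q A equal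
  ... | tri≈ _ p≡q _ = ⊥-elim (p≢q p≡q)
  ... | tri> _ _ q<p = det-equalColumns (toℕ p) q p ≡.refl q<p A (λ k → sym (equal k))

  -- Cramer's rule for the right-hand side (1, 0, …, 0), summed over the
  -- components of the solution.
  cramer : ∀ {n} (A B : Matrix (suc n)) (f : Fin (suc n) → Carrier) →
    sum (λ l → A zero l * f l) ≈ 1# →
    (∀ k → sum (λ l → A (suc k) l * f l) ≈ 0#) →
    (∀ l → B zero l ≈ 1#) → (∀ k l → B (suc k) l ≈ A (suc k) l) →
    determinant B ≈ sum f * determinant A
  cramer {n} A B f Af-zero Af-suc B-zero B-suc = begin
    sum (expansion B)
      ≈⟨ sum-cong (expansion B) (λ l → f l * determinant A) (λ l → trans
           (*-congˡ (trans (*-cong (B-zero l)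
             (det-cong (minor B l) (minor A l) λ k j → B-suc k (punchIn l j))) (*-identityˡ _)))
           (sym (component l))) ⟩
    sum (λ l → f l * determinant A)
      ≈⟨ *-distribʳ-sum (determinant A) f ⟨
    sum f * determinant A ∎
    where
    column : Fin (suc n) → Fin (suc n) → Carrier
    column j k = A k j

    -- The vector A f, which the hypotheses identify with the first unit vector.
    e₀ : Fin (suc n) → Carrier
    e₀ k = sum (λ j → f j * column j k)

    e₀-zero : e₀ zero ≈ 1#
    e₀-zero = trans (sum-cong (λ j → f j * A zero j) (λ j → A zero j * f j) (λ j → *-comm _ _)) Af-zero

    e₀-suc : ∀ k → e₀ (suc k) ≈ 0#
    e₀-suc k = trans (sum-cong (λ j → f j * A (suc k) j) (λ j → A (suc k) j * f j)
                 (λ j → *-comm _ _)) (Af-suc k)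

    -- Put the combination `e₀` of all columns into column l. By linearity and alternation this
    -- multiplies det A by f l; since `e₀` is a unit vector, it also leaves only the cofactor of the
    -- entry (0, l).
    component : ∀ l → f l * determinant A ≈ sgn l * determinant (minor A l)
    component l = begin
      f l * determinant A
        ≈⟨ *-congˡ (det-cong A (replaceColumn A l (column l)) unchanged) ⟩
      f l * determinant (replaceColumn A l (column l))
        ≈⟨ sum-single l (λ j → f j * determinant (replaceColumn A l (column j))) (λ j j≢l →
             trans (*-congˡ (det-alternating j≢l (replaceColumn A l (column j)) λ k →
               trans (replaceColumn-off A l (column j) k j≢l)
                 (sym (replaceColumn-at A l (column j) k)))) (zeroʳ _)) ⟨
      sum (λ j → f j * determinant (replaceColumn A l (column j)))
        ≈⟨ det-replaceColumn-sum A l f column ⟨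
      determinant N
        ≈⟨ sum-single l (expansion N) off-l ⟩
      sgn l * (N zero l * determinant (minor N l))
        ≈⟨ *-congˡ (*-cong (trans (replaceColumn-at A l e₀ zero) e₀-zero)
             (det-cong (minor N l) (minor A l) λ k j →
               replaceColumn-off A l e₀ (suc k) (Fin.punchInᵢ≢i l j))) ⟩
      sgn l * (1# * determinant (minor A l))
        ≈⟨ *-congˡ (*-identityˡ _) ⟩
      sgn l * determinant (minor A l) ∎
      where
      N = replaceColumn A l e₀

      unchanged : ∀ k j → A k j ≈ replaceColumn A l (column l) k j
      unchanged k j with j Fin.≟ l
      ... | yes ≡.refl = sym (replaceColumn-at A l (column l) k)
      ... | no j≢l     = sym (replaceColumn-off A l (column l) k j≢l)

      -- The minor without column j still contains column l, whose entries below the first row are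
      -- zero.
      off-l : ∀ j → j ≢ l → expansion N j ≈ 0#
      off-l j j≢l = trans (*-congˡ (trans (*-congˡ
        (det-zeroColumn (punchOut j≢l) (minor N j) λ k → ≡.subst (λ i → N (suc k) i ≈ 0#)
          (≡.sym (Fin.punchIn-punchOut j≢l))
          (trans (replaceColumn-at A l e₀ (suc k)) (e₀-suc k))))
        (zeroʳ _))) (zeroʳ _)

module ConstantTerm {c ℓ} (R : CommutativeRing c ℓ) where
  open CommutativeRing R hiding (zero)
  open PowerSeriesRing R
  open FiniteSums R
  open DeterminantProperties commutativeRing
  open Determinant (PowerSeries.rawRing rawRing) renaming (det to determinant)
  open import Relation.Binary.Reasoning.Setoid setoid

  private
    module S = RawRing (PowerSeries.rawRing rawRing)

  constantTerm-* : ∀ f g → (f S.* g) 0 ≈ f 0 * g 0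
  constantTerm-* f g = +-identityʳ _

  -- Constant terms multiply, so this is the determinant of the identity matrix: in the first row
  -- only the diagonal entry contributes. It is what makes det M invertible.
  constantTerm-det : ∀ {n} (A : Fin n → Fin n → S.Carrier) →
    (∀ k → A k k 0 ≈ 1#) → (∀ k l → l ≢ k → A k l 0 ≈ 0#) → determinant A 0 ≈ 1#
  constantTerm-det {zero}  A diagonal off-diagonal = refl
  constantTerm-det {suc n} A diagonal off-diagonal = begin
    determinant A 0
      ≈⟨ sum-coefficient (expansion A) 0 ⟩
    sum (λ j → expansion A j 0)
      ≈⟨ sum-single zero (λ j → expansion A j 0) (λ j j≢0 →
           trans (constantTerm-* (sgn j) (A zero j S.* determinant (minor A j))) (trans (*-congˡ
             (trans (constantTerm-* (A zero j) (determinant (minor A j)))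
               (trans (*-congʳ (off-diagonal zero j j≢0)) (zeroˡ _)))) (zeroʳ _))) ⟩
    expansion A zero 0
      ≈⟨ trans (constantTerm-* S.1# (A zero zero S.* determinant (minor A zero)))
           (trans (*-identityˡ _) (constantTerm-* (A zero zero) (determinant (minor A zero)))) ⟩
    A zero zero 0 * determinant (minor A zero) 0
      ≈⟨ *-cong (diagonal zero) (constantTerm-det (minor A zero) (λ k → diagonal (suc k))
           (λ k l l≢k → off-diagonal (suc k) (suc l) (l≢k ∘ Fin.suc-injective))) ⟩
    1# * 1#
      ≈⟨ *-identityˡ _ ⟩
    1# ∎

-- Permutations with a given up-down sequence

open ≡ using (refl; sym; trans; cong; cong₂; subst; setoid; module ≡-Reasoning)

witness : ∀ {A : Set} (A? : Dec A) → does A? ≡ true → A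
witness (yes a) _ = a

refutation : ∀ {A : Set} (A? : Dec A) → does A? ≡ false → ¬ A
refutation (no ¬a) _ = ¬a

-- In a list without repetitions membership has at most one proof, so two such lists with the same
-- members are equal as bags, hence permutations of each other.
length-bijection : ∀ {A B : Set} {xs : List A} {ys : List B} (f : A → B) →
  (∀ {u v} → f u ≡ f v → u ≡ v) → List.Unique xs → List.Unique ys →
  (∀ {x} → x ∈ xs → f x ∈ ys) → (∀ {y} → y ∈ ys → ∃ λ x → x ∈ xs × y ≡ f x) →
  length xs ≡ length ys
length-bijection {B = B} {xs} {ys} f f-injective xs-unique ys-unique into onto =
  trans (sym (List.length-map f xs)) (↭-length (∼bag⇒↭ λ {v} →
    mk↔ₛ′ to from (λ p → irrelevant ys-unique _ p)
      (λ p → irrelevant (ListUnique.map⁺ f-injective xs-unique) _ p)))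
  where
  irrelevant : ∀ {zs : List B} → List.Unique zs → ∀ {v} (p q : v ∈ zs) → p ≡ q
  irrelevant = unique⇒irrelevant (setoid B) (λ { refl refl → refl })
  to : ∀ {v} → v ∈ List.map f xs → v ∈ ys
  to p with ∈.∈-map⁻ f p
  ... | x , x∈xs , refl = into x∈xs
  from : ∀ {v} → v ∈ ys → v ∈ List.map f xs
  from p with onto p
  ... | x , x∈xs , refl = ∈.∈-map⁺ f x∈xs

length-filter-⊎ : ∀ {A : Set} {P Q R : Pred A 0ℓ}
  (P? : Decidable P) (Q? : Decidable Q) (R? : Decidable R) →
  (∀ {x} → P x → Q x ⊎ R x) → (∀ {x} → Q x → P x) → (∀ {x} → R x → P x) →
  (∀ {x} → Q x → ¬ R x) → ∀ xs →
  length (filter P? xs) ≡ length (filter Q? xs) ℕ.+ length (filter R? xs)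
length-filter-⊎ P? Q? R? split Q⇒P R⇒P disjoint [] = refl
length-filter-⊎ P? Q? R? split Q⇒P R⇒P disjoint (x ∷ xs)
  with ih ← length-filter-⊎ P? Q? R? split Q⇒P R⇒P disjoint xs
  with P? x | Q? x | R? x
... | yes p | yes q | yes r = ⊥-elim (disjoint q r)
... | yes p | yes q | no ¬r = cong suc ih
... | yes p | no ¬q | yes r = trans (cong suc ih) (sym (ℕ.+-suc _ _))
... | no ¬p | yes q | _     = ⊥-elim (¬p (Q⇒P q))
... | no ¬p | no ¬q | yes r = ⊥-elim (¬p (R⇒P r))
... | no ¬p | no ¬q | no ¬r = ih
... | yes p | no ¬q | no ¬r with split p
...   | inj₁ q = ⊥-elim (¬q q)
...   | inj₂ r = ⊥-elim (¬r r)

length-filter-none : ∀ {A : Set} {P : Pred A 0ℓ} (P? : Decidable P) → (∀ x → ¬ P x) →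
  ∀ xs → length (filter P? xs) ≡ 0
length-filter-none P? ¬P xs = cong length (List.filter-none P? (ListAll.universal ¬P xs))

words-unique : ∀ n k → List.Unique (words n k)
words-unique n zero    = ListAll.[] ListAllPairs.∷ ListAllPairs.[]
words-unique n (suc k) = ListUnique.cartesianProductWith⁺ _∷_ Vec.∷-injective
  (ListUnique.allFin⁺ n) (words-unique n k)

∈-words : ∀ {n k} (σ : Vec (Fin n) k) → σ ∈ words n k
∈-words []      = here refl
∈-words (a ∷ σ) = ∈.∈-cartesianProductWith⁺ _∷_ (∈.∈-allFin a) (∈-words σ)

module _ {A : Set} {P : Pred A 0ℓ} where

  All-∷ʳ⁺ : ∀ {n a} {xs : Vec A n} → All P xs → P a → All P (xs ∷ʳ a)
  All-∷ʳ⁺ []         pa = pa ∷ []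
  All-∷ʳ⁺ (px ∷ pxs) pa = px ∷ All-∷ʳ⁺ pxs pa

  All-∷ʳ⁻ : ∀ {n a} (xs : Vec A n) → All P (xs ∷ʳ a) → All P xs × P a
  All-∷ʳ⁻ []       (pa ∷ [])  = [] , pa
  All-∷ʳ⁻ (x ∷ xs) (px ∷ pxs) = let qxs , pa = All-∷ʳ⁻ xs pxs in px ∷ qxs , pa

module _ {A : Set} where

  Unique-∷ʳ⁺ : ∀ {n a} {xs : Vec A n} → Unique xs → All (_≢ a) xs → Unique (xs ∷ʳ a)
  Unique-∷ʳ⁺ []        []          = [] ∷ []
  Unique-∷ʳ⁺ (x∉ ∷ u) (x≢a ∷ ≢a) = All-∷ʳ⁺ x∉ x≢a ∷ Unique-∷ʳ⁺ u ≢a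

  Unique-∷ʳ⁻ : ∀ {n a} (xs : Vec A n) → Unique (xs ∷ʳ a) → Unique xs × All (_≢ a) xs
  Unique-∷ʳ⁻ []       _        = [] , []
  Unique-∷ʳ⁻ (x ∷ xs) (x∉ ∷ u) =
    let x∉xs , x≢a = All-∷ʳ⁻ xs x∉
        u′ , ≢a    = Unique-∷ʳ⁻ xs u
    in x∉xs ∷ u′ , x≢a ∷ ≢a

  Unique-map⁻ : ∀ {B : Set} (f : A → B) {n} (xs : Vec A n) → Unique (Vec.map f xs) → Unique xs
  Unique-map⁻ f []       []       = []
  Unique-map⁻ f (x ∷ xs) (x∉ ∷ u) =
    All.map (λ fx≢fy x≡y → fx≢fy (cong f x≡y)) (All.map⁻ x∉) ∷ Unique-map⁻ f xs u

map-injective : ∀ {A B : Set} {f : A → B} → (∀ {a b} → f a ≡ f b → a ≡ b) →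
  ∀ {n} (xs ys : Vec A n) → Vec.map f xs ≡ Vec.map f ys → xs ≡ ys
map-injective f-injective []       []       _  = refl
map-injective f-injective (x ∷ xs) (y ∷ ys) eq = cong₂ _∷_
  (f-injective (Vec.∷-injectiveˡ eq)) (map-injective f-injective xs ys (Vec.∷-injectiveʳ eq))

last-map : ∀ {A B : Set} (f : A → B) {n} (xs : Vec A (suc n)) →
           last (Vec.map f xs) ≡ f (last xs)
last-map f (x ∷ [])     = refl
last-map f (x ∷ y ∷ xs) = last-map f (y ∷ xs)

tabulate-∷ʳ : ∀ {A : Set} (f : ℕ → A) n →
              tabulate {n = suc n} (f ∘ toℕ) ≡ tabulate {n = n} (f ∘ toℕ) ∷ʳ f n
tabulate-∷ʳ f zero    = refl
tabulate-∷ʳ f (suc n) = cong (f 0 ∷_) (tabulate-∷ʳ (f ∘ suc) n)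

punchIn-mono-< : ∀ {n} j {a b : Fin n} → a Fin.< b → punchIn j a Fin.< punchIn j b
punchIn-mono-< j {a} {b} a<b = ℕ.≰⇒> λ b≤a → ℕ.<⇒≱ a<b (Fin.punchIn-cancel-≤ j b a b≤a)

punchIn-cancel-< : ∀ {n} j {a b : Fin n} → punchIn j a Fin.< punchIn j b → a Fin.< b
punchIn-cancel-< j {a} {b} a<b = ℕ.≰⇒> λ b≤a → ℕ.<⇒≱ a<b (Fin.punchIn-mono-≤ j b a b≤a)

-- Values below the gap j are not shifted, all others end up above it.
punchIn<⁻ : ∀ {n} (j : Fin (suc n)) a → punchIn j a Fin.< j → toℕ a ℕ.< toℕ j
punchIn<⁻ (suc j) zero    _       = ℕ.z<s
punchIn<⁻ (suc j) (suc a) (ℕ.s≤s p) = ℕ.s≤s (punchIn<⁻ j a p)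

punchIn<⁺ : ∀ {n} (j : Fin (suc n)) a → toℕ a ℕ.< toℕ j → punchIn j a Fin.< j
punchIn<⁺ (suc j) zero    _       = ℕ.z<s
punchIn<⁺ (suc j) (suc a) (ℕ.s≤s p) = ℕ.s≤s (punchIn<⁺ j a p)

upDown-∷ʳ : ∀ {m n} (σ : Vec (Fin m) (suc n)) a →
            upDown (σ ∷ʳ a) ≡ upDown σ ∷ʳ does (last σ Fin.<? a)
upDown-∷ʳ (b ∷ [])    a = refl
upDown-∷ʳ (b ∷ c ∷ σ) a = cong (does (b Fin.<? c) ∷_) (upDown-∷ʳ (c ∷ σ) a)

upDown-punchIn : ∀ {m n} j (σ : Vec (Fin m) (suc n)) →
                 upDown (Vec.map (punchIn j) σ) ≡ upDown σ
upDown-punchIn j (b ∷ [])    = refl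
upDown-punchIn j (b ∷ c ∷ σ) = cong₂ _∷_
  (does-⇔ (mk⇔ (punchIn-cancel-< j) (punchIn-mono-< j)) (_ Fin.<? _) (b Fin.<? c))
  (upDown-punchIn j (c ∷ σ))

-- The permutation whose last value is j and whose other values are in the
-- same relative order as τ.
extend : ∀ {n k} → Fin (suc n) → Vec (Fin n) k → Vec (Fin (suc n)) (suc k)
extend j τ = Vec.map (punchIn j) τ ∷ʳ j

extend-injective : ∀ {n k} j {τ τ′ : Vec (Fin n) k} → extend j τ ≡ extend j τ′ → τ ≡ τ′
extend-injective j {τ} {τ′} eq = map-injective (Fin.punchIn-injective j _ _) τ τ′ (Vec.∷ʳ-injectiveˡ _ _ eq)

-- Opening a gap at j preserves all earlier comparisons. The new step compares values of different
-- `Fin` types, hence through `toℕ`: it is an ascent when the old last value lies below the gap.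
upDown-extend : ∀ {m n} j (τ : Vec (Fin m) (suc n)) →
  upDown (extend j τ) ≡ upDown τ ∷ʳ does (toℕ (last τ) ℕ.<? toℕ j)
upDown-extend j τ = trans (upDown-∷ʳ (Vec.map (punchIn j) τ) j) (cong₂ _∷ʳ_ (upDown-punchIn j τ)
  (trans (cong (λ a → does (a Fin.<? j)) (last-map (punchIn j) τ))
    (does-⇔ (mk⇔ (punchIn<⁻ j (last τ)) (punchIn<⁺ j (last τ)))
      (punchIn j (last τ) Fin.<? j) (toℕ (last τ) ℕ.<? toℕ j))))

Unique-extend : ∀ {n k} j (τ : Vec (Fin n) k) → Unique τ → Unique (extend j τ)
Unique-extend j τ u = Unique-∷ʳ⁺ (Unique.map⁺ (Fin.punchIn-injective j _ _) u)
  (All.map⁺ (All.universal (Fin.punchInᵢ≢i j) τ))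

punchIn-surjective : ∀ {n k} j (σ : Vec (Fin (suc n)) k) → All (_≢ j) σ →
                     ∃ λ τ → σ ≡ Vec.map (punchIn j) τ
punchIn-surjective j []      []          = [] , refl
punchIn-surjective j (a ∷ σ) (a≢j ∷ σ≢j) =
  let τ , eq = punchIn-surjective j σ σ≢j
  in punchOut (a≢j ∘ sym) ∷ τ , cong₂ _∷_ (sym (Fin.punchIn-punchOut (a≢j ∘ sym))) eq

-- Recurrences for the triangle by removal of the last entry

module _ (P : ℕ → Bool) (n : ℕ) where

  -- The permutations of length n + 1 that follow `P` and still do so after the zero-based value j
  -- is appended. As j is a natural number, the conditions for j and j + 1 concern the same vectors
  -- and can be compared.
  Extendable : ℕ → Vec (Fin (suc n)) (suc n) → Set
  Extendable j τ =
    Unique τ × upDown τ ≡ tabulate (P ∘ toℕ) × does (toℕ (last τ) ℕ.<? j) ≡ P n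

  extendable? : ∀ j → Decidable (Extendable j)
  extendable? j τ =
    allPairs? (λ u v → ¬? (u Fin.≟ v)) τ
    ×-dec Vec.≡-dec Bool._≟_ (upDown τ) (tabulate (P ∘ toℕ))
    ×-dec (does (toℕ (last τ) ℕ.<? j) Bool.≟ P n)

  #Extendable : ℕ → ℕ
  #Extendable j = length (filter (extendable? j) (words (suc n) (suc n)))

  -- Deleting the last entry and closing the gap in the values inverts `extend j`. Entries of row n
  -- + 2 thus become counts over one and the same list of shorter words.
  ♯≡#Extendable : ∀ j → ♯ P (2 ℕ.+ n) (suc (toℕ j)) ≡ #Extendable (toℕ j)
  ♯≡#Extendable j = sym (length-bijection (extend j) (extend-injective j)
    (ListUnique.filter⁺ (extendable? (toℕ j)) (words-unique _ _))
    (ListUnique.filter⁺ (counted? P (suc n) (suc (toℕ j))) (words-unique _ _))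
    into onto)
    where
    into : ∀ {τ} → τ ∈ filter (extendable? (toℕ j)) (words _ _) →
           extend j τ ∈ filter (counted? P (suc n) (suc (toℕ j))) (words _ _)
    into {τ} τ∈ with ∈.∈-filter⁻ (extendable? (toℕ j)) {xs = words _ _} τ∈
    ... | _ , u , up , step = ∈.∈-filter⁺ (counted? P (suc n) (suc (toℕ j))) (∈-words (extend j τ))
      ( Unique-extend j τ u
      , trans (upDown-extend j τ) (trans (cong₂ _∷ʳ_ up step) (sym (tabulate-∷ʳ P n)))
      , cong (suc ∘ toℕ) (Vec.last-∷ʳ j (Vec.map (punchIn j) τ)))

    onto : ∀ {σ} → σ ∈ filter (counted? P (suc n) (suc (toℕ j))) (words _ _) →
           ∃ λ τ → τ ∈ filter (extendable? (toℕ j)) (words _ _) × σ ≡ extend j τ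
    onto {σ} σ∈ with ∈.∈-filter⁻ (counted? P (suc n) (suc (toℕ j))) {xs = words _ _} σ∈
    ... | _ , u , up , last≡j with initLast σ
    ... | σ′ , a , refl
      with refl ← Fin.toℕ-injective (ℕ.suc-injective last≡j)
      with u′ , ≢j ← Unique-∷ʳ⁻ σ′ u
      with τ , refl ← punchIn-surjective j σ′ ≢j =
      let up′ , step = Vec.∷ʳ-injective (upDown τ) (tabulate (P ∘ toℕ))
                         (trans (sym (upDown-extend j τ)) (trans up (tabulate-∷ʳ P n)))
      in τ , ∈.∈-filter⁺ (extendable? (toℕ j)) (∈-words τ) (Unique-map⁻ (punchIn j) τ u′ , up′ , step)
           , refl

  ♯≡#Extendable′ : ∀ {j} → j ℕ.≤ suc n → ♯ P (2 ℕ.+ n) (suc j) ≡ #Extendable j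
  ♯≡#Extendable′ {j} j≤n+1 = subst (λ i → ♯ P (2 ℕ.+ n) (suc i) ≡ #Extendable i)
    (Fin.toℕ-fromℕ< (ℕ.s≤s j≤n+1)) (♯≡#Extendable (fromℕ< (ℕ.s≤s j≤n+1)))

  -- Before an ascent to j + 1 the shorter permutation ends below j + 1, that is, below j or at j;
  -- the second case is counted by the previous row.
  ♯-ascent : P n ≡ true → ∀ {j} → j ℕ.≤ n →
    ♯ P (2 ℕ.+ n) (2 ℕ.+ j) ≡ ♯ P (2 ℕ.+ n) (suc j) ℕ.+ ♯ P (suc n) (suc j)
  ♯-ascent Pn {j} j≤n = begin
    ♯ P (2 ℕ.+ n) (2 ℕ.+ j)
      ≡⟨ ♯≡#Extendable′ (ℕ.s≤s j≤n) ⟩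
    #Extendable (suc j)
      ≡⟨ length-filter-⊎ (extendable? (suc j)) (extendable? j) (counted? P n (suc j))
           split weaken include disjoint (words (suc n) (suc n)) ⟩
    #Extendable j ℕ.+ ♯ P (suc n) (suc j)
      ≡⟨ cong (ℕ._+ ♯ P (suc n) (suc j)) (♯≡#Extendable′ (ℕ.m≤n⇒m≤1+n j≤n)) ⟨
    ♯ P (2 ℕ.+ n) (suc j) ℕ.+ ♯ P (suc n) (suc j) ∎
    where
    open ≡-Reasoning
    below : ∀ {a b} → does (a ℕ.<? b) ≡ P n → a ℕ.< b
    below {a} {b} eq = witness (a ℕ.<? b) (trans eq Pn)
    below⁻ : ∀ {a b} → a ℕ.< b → does (a ℕ.<? b) ≡ P n
    below⁻ {a} {b} a<b = trans (dec-true (a ℕ.<? b) a<b) (sym Pn)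

    split : ∀ {τ} → Extendable (suc j) τ → Extendable j τ ⊎ Counted P n (suc j) τ
    split {τ} (u , up , step) with ℕ.m<1+n⇒m<n∨m≡n (below {toℕ (last τ)} {suc j} step)
    ... | inj₁ <j = inj₁ (u , up , below⁻ <j)
    ... | inj₂ ≡j = inj₂ (u , up , cong suc ≡j)
    weaken : ∀ {τ} → Extendable j τ → Extendable (suc j) τ
    weaken {τ} (u , up , step) = u , up , below⁻ (ℕ.m<n⇒m<1+n (below {toℕ (last τ)} {j} step))
    include : ∀ {τ} → Counted P n (suc j) τ → Extendable (suc j) τ
    include (u , up , eq) = u , up , below⁻ (ℕ.≤-reflexive eq)
    disjoint : ∀ {τ} → Extendable j τ → ¬ Counted P n (suc j) τ
    disjoint {τ} (_ , _ , step) (_ , _ , eq) =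
      ℕ.<⇒≢ (below {toℕ (last τ)} {j} step) (ℕ.suc-injective eq)

  -- Before a descent to j the shorter permutation ends at j or above. Splitting off equality now
  -- raises j, so the neighbours in the row exchange their roles.
  ♯-descent : P n ≡ false → ∀ {j} → j ℕ.≤ n →
    ♯ P (2 ℕ.+ n) (suc j) ≡ ♯ P (2 ℕ.+ n) (2 ℕ.+ j) ℕ.+ ♯ P (suc n) (suc j)
  ♯-descent Pn {j} j≤n = begin
    ♯ P (2 ℕ.+ n) (suc j)
      ≡⟨ ♯≡#Extendable′ (ℕ.m≤n⇒m≤1+n j≤n) ⟩
    #Extendable j
      ≡⟨ length-filter-⊎ (extendable? j) (extendable? (suc j)) (counted? P n (suc j))
           split weaken include disjoint (words (suc n) (suc n)) ⟩
    #Extendable (suc j) ℕ.+ ♯ P (suc n) (suc j)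
      ≡⟨ cong (ℕ._+ ♯ P (suc n) (suc j)) (♯≡#Extendable′ (ℕ.s≤s j≤n)) ⟨
    ♯ P (2 ℕ.+ n) (2 ℕ.+ j) ℕ.+ ♯ P (suc n) (suc j) ∎
    where
    open ≡-Reasoning
    above : ∀ {a b} → does (a ℕ.<? b) ≡ P n → b ℕ.≤ a
    above {a} {b} eq = ℕ.≮⇒≥ (refutation (a ℕ.<? b) (trans eq Pn))
    above⁻ : ∀ {a b} → b ℕ.≤ a → does (a ℕ.<? b) ≡ P n
    above⁻ {a} {b} b≤a = trans (dec-false (a ℕ.<? b) (ℕ.≤⇒≯ b≤a)) (sym Pn)

    split : ∀ {τ} → Extendable j τ → Extendable (suc j) τ ⊎ Counted P n (suc j) τ
    split {τ} (u , up , step) with ℕ.m≤n⇒m<n∨m≡n (above {toℕ (last τ)} {j} step)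
    ... | inj₁ j< = inj₁ (u , up , above⁻ j<)
    ... | inj₂ j≡ = inj₂ (u , up , cong suc (sym j≡))
    weaken : ∀ {τ} → Extendable (suc j) τ → Extendable j τ
    weaken {τ} (u , up , step) = u , up , above⁻ (ℕ.<⇒≤ (above {toℕ (last τ)} {suc j} step))
    include : ∀ {τ} → Counted P n (suc j) τ → Extendable j τ
    include (u , up , eq) = u , up , above⁻ (ℕ.≤-reflexive (sym (ℕ.suc-injective eq)))
    disjoint : ∀ {τ} → Extendable (suc j) τ → ¬ Counted P n (suc j) τ
    disjoint {τ} (_ , _ , step) (_ , _ , eq) =
      ℕ.<⇒≢ (above {toℕ (last τ)} {suc j} step) (sym (ℕ.suc-injective eq))

  ♯-ascent-first : P n ≡ true → ♯ P (2 ℕ.+ n) 1 ≡ 0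
  ♯-ascent-first Pn = trans (♯≡#Extendable′ ℕ.z≤n)
    (length-filter-none (extendable? 0) never (words (suc n) (suc n)))
    where
    never : ∀ τ → ¬ Extendable 0 τ
    never τ (_ , _ , step) with () ← trans step Pn

  ♯-descent-last : P n ≡ false → ♯ P (2 ℕ.+ n) (2 ℕ.+ n) ≡ 0
  ♯-descent-last Pn = trans (♯≡#Extendable′ ℕ.≤-refl)
    (length-filter-none (extendable? (suc n)) never (words (suc n) (suc n)))
    where
    never : ∀ τ → ¬ Extendable (suc n) τ
    never τ (_ , _ , step)
      with () ← trans (sym (dec-true (toℕ (last τ) ℕ.<? suc n) (Fin.toℕ<n (last τ)))) (trans step Pn)

-- The functional equation of F

ℚ-ring : CommutativeRing _ _
ℚ-ring = ℚ.+-*-commutativeRing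

open import Algebra.Properties.Semiring.Mult (CommutativeRing.semiring ℚ-ring)
  using (×-assoc-*; ×-comm-*) renaming (_×_ to _·_)
open import Algebra.Properties.CommutativeSemigroup
  (CommutativeRing.*-commutativeSemigroup ℚ-ring) using (x∙yz≈y∙xz)

-- Fractions are normalised in `ℚ`, so identities between them are computed in the unnormalised
-- rationals and carried over.
fromℚᵘ-homo-* : ∀ p q → fromℚᵘ p ℚ.* fromℚᵘ q ≡ fromℚᵘ (p ℚᵘ.* q)
fromℚᵘ-homo-* p q = ℚ.toℚᵘ-injective (ℚᵘ.≃-trans (ℚ.toℚᵘ-homo-* (fromℚᵘ p) (fromℚᵘ q))
  (ℚᵘ.≃-trans (ℚᵘ.*-cong (ℚ.toℚᵘ-fromℚᵘ p) (ℚ.toℚᵘ-fromℚᵘ q)) (ℚᵘ.≃-sym (ℚ.toℚᵘ-fromℚᵘ _))))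

fromℚᵘ-homo-+ : ∀ p q → fromℚᵘ p ℚ.+ fromℚᵘ q ≡ fromℚᵘ (p ℚᵘ.+ q)
fromℚᵘ-homo-+ p q = ℚ.toℚᵘ-injective (ℚᵘ.≃-trans (ℚ.toℚᵘ-homo-+ (fromℚᵘ p) (fromℚᵘ q))
  (ℚᵘ.≃-trans (ℚᵘ.+-cong (ℚ.toℚᵘ-fromℚᵘ p) (ℚ.toℚᵘ-fromℚᵘ q)) (ℚᵘ.≃-sym (ℚ.toℚᵘ-fromℚᵘ _))))

/-homo-* : ∀ a b m n .{{_ : NonZero m}} .{{_ : NonZero n}} →
  (a ℚ./ m) ℚ.* (b ℚ./ n) ≡ ((a ℤ.* b) ℚ./ (m ℕ.* n)) {{ℕ.m*n≢0 m n}}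
/-homo-* a b (suc m) (suc n) = fromℚᵘ-homo-* (mkℚᵘ a m) (mkℚᵘ b n)

ι : ℤ → ℚ
ι z = z ℚ./ 1

ι-homo-+ : ∀ a b → ι (a ℤ.+ b) ≡ ι a ℚ.+ ι b
ι-homo-+ a b = trans
  (cong₂ (λ u v → ι (u ℤ.+ v)) (sym (ℤ.*-identityʳ a)) (sym (ℤ.*-identityʳ b)))
  (sym (fromℚᵘ-homo-+ (mkℚᵘ a 0) (mkℚᵘ b 0)))

·≡ι* : ∀ n q → n · q ≡ ι (+ n) ℚ.* q
·≡ι* zero    q = sym (ℚ.*-zeroˡ q)
·≡ι* (suc n) q = begin
  q ℚ.+ n · q                  ≡⟨ cong₂ ℚ._+_ (sym (ℚ.*-identityˡ q)) (·≡ι* n q) ⟩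
  1ℚ ℚ.* q ℚ.+ ι (+ n) ℚ.* q   ≡⟨ ℚ.*-distribʳ-+ q 1ℚ (ι (+ n)) ⟨
  (1ℚ ℚ.+ ι (+ n)) ℚ.* q       ≡⟨ cong (ℚ._* q) (ι-homo-+ 1ℤ (+ n)) ⟨
  ι (+ suc n) ℚ.* q            ∎
  where open ≡-Reasoning

1/suc : ℕ → ℚ
1/suc n = 1ℤ ℚ./ suc n

·-1/suc : ∀ n → suc n · 1/suc n ≡ 1ℚ
·-1/suc n = trans (·≡ι* (suc n) (1/suc n)) (trans (fromℚᵘ-homo-* (mkℚᵘ (+ suc n) 0) (mkℚᵘ 1ℤ n))
  (ℚ.fromℚᵘ-cong {mkℚᵘ (+ suc n) 0 ℚᵘ.* mkℚᵘ 1ℤ n} {mkℚᵘ 1ℤ 0} (*≡* (begin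
    + suc n ℤ.* 1ℤ ℤ.* 1ℤ          ≡⟨ trans (ℤ.*-identityʳ _) (ℤ.*-identityʳ _) ⟩
    + suc n                        ≡⟨ cong +_ (ℕ.*-identityˡ (suc n)) ⟨
    + (1 ℕ.* suc n)                ≡⟨ ℤ.*-identityˡ _ ⟨
    1ℤ ℤ.* + (1 ℕ.* suc n)         ∎))))
  where open ≡-Reasoning

·-cancelˡ : ∀ n {a b} → suc n · a ≡ suc n · b → a ≡ b
·-cancelˡ n {a} {b} eq = trans (sym (undo a)) (trans (cong (1/suc n ℚ.*_) eq) (undo b))
  where
  open ≡-Reasoning
  undo : ∀ a → 1/suc n ℚ.* (suc n · a) ≡ a
  undo a = begin
    1/suc n ℚ.* (suc n · a)   ≡⟨ ×-comm-* (suc n) (1/suc n) a ⟩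
    suc n · (1/suc n ℚ.* a)   ≡⟨ ×-assoc-* (suc n) (1/suc n) a ⟨
    (suc n · 1/suc n) ℚ.* a   ≡⟨ cong (ℚ._* a) (·-1/suc n) ⟩
    1ℚ ℚ.* a                  ≡⟨ ℚ.*-identityˡ a ⟩
    a                         ∎

exp-suc : ∀ n → suc n · exp (suc n) ≡ exp n
exp-suc n = begin
  suc n · exp (suc n)             ≡⟨ cong (suc n ·_) (/-homo-* 1ℤ 1ℤ (suc n) (n !) {{_}} {{n ℕ.!≢0}}) ⟨
  suc n · (1/suc n ℚ.* exp n)     ≡⟨ ×-assoc-* (suc n) (1/suc n) (exp n) ⟨
  (suc n · 1/suc n) ℚ.* exp n     ≡⟨ cong (ℚ._* exp n) (·-1/suc n) ⟩
  1ℚ ℚ.* exp n                    ≡⟨ ℚ.*-identityˡ _ ⟩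
  exp n                           ∎
  where open ≡-Reasoning

module _ (P : ℕ → Bool) where

  signed : ℕ → ℕ → ℤ
  signed i j = ε P i ℤ.* + ♯ P i j

  -- The array c(a,b): the coefficients of F with respect to x^a/a! and y^b/b!.
  coefficient : ℕ → ℕ → ℚ
  coefficient a b = ι (signed (suc (a ℕ.+ b)) (suc b))

  F-coefficient : ∀ a b → F P a b ≡ coefficient a b ℚ.* (exp a ℚ.* exp b)
  F-coefficient a b = sym (begin
    ι s ℚ.* (exp a ℚ.* exp b)
      ≡⟨ cong (ι s ℚ.*_) (/-homo-* 1ℤ 1ℤ (a !) (b !) {{a ℕ.!≢0}} {{b ℕ.!≢0}}) ⟩
    ι s ℚ.* (1ℤ ℚ./ (a ! ℕ.* b !)) {{a ℕ.!* b !≢0}}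
      ≡⟨ /-homo-* s 1ℤ 1 (a ! ℕ.* b !) {{_}} {{a ℕ.!* b !≢0}} ⟩
    ((s ℤ.* 1ℤ) ℚ./ (1 ℕ.* (a ! ℕ.* b !))) {{ℕ.m*n≢0 1 (a ! ℕ.* b !) {{_}} {{a ℕ.!* b !≢0}}}}
      -- In `F` the first factorial is that of `a + b ∸ b`, which has to be identified with a.
      ≡⟨ ℚ./-cong {{ℕ.m*n≢0 1 (a ! ℕ.* b !) {{_}} {{a ℕ.!* b !≢0}}}} {{(a ℕ.+ b ∸ b) ℕ.!* b !≢0}}
           (ℤ.*-identityʳ s)
           (trans (ℕ.*-identityˡ _) (cong (λ k → k ! ℕ.* b !) (sym (ℕ.m+n∸n≡m a b)))) ⟩
    F P a b ∎)
    where
    open ≡-Reasoning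
    s = signed (suc (a ℕ.+ b)) (suc b)

  ε-suc : ∀ n → ε P (2 ℕ.+ n) ≡ -1ℤ ℤ.^ p̄ (P n) ℤ.* ε P (suc n)
  ε-suc n = trans (cong (-1ℤ ℤ.^_) (trans (sum-tabulate-suc (p̄ ∘ P) n) (ℕ.+-comm _ (p̄ (P n)))))
    (ℤ.^-distribˡ-+-* -1ℤ (p̄ (P n)) _)
    where
    sum-tabulate-suc : ∀ (g : ℕ → ℕ) n → Vec.sum (tabulate {n = suc n} (g ∘ toℕ)) ≡
                       Vec.sum (tabulate {n = n} (g ∘ toℕ)) ℕ.+ g n
    sum-tabulate-suc g zero    = ℕ.+-identityʳ (g 0)
    sum-tabulate-suc g (suc n) = trans (cong (g 0 ℕ.+_) (sum-tabulate-suc (g ∘ suc) n))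
                                   (sym (ℕ.+-assoc (g 0) _ _))

  ε-ascent : ∀ {n} → P n ≡ true → ε P (2 ℕ.+ n) ≡ ε P (suc n)
  ε-ascent {n} Pn = trans (ε-suc n)
    (trans (cong (λ q → -1ℤ ℤ.^ p̄ q ℤ.* ε P (suc n)) Pn) (ℤ.*-identityˡ _))

  ε-descent : ∀ {n} → P n ≡ false → ε P (2 ℕ.+ n) ≡ ℤ.- ε P (suc n)
  ε-descent {n} Pn = trans (ε-suc n)
    (trans (cong (λ q → -1ℤ ℤ.^ p̄ q ℤ.* ε P (suc n)) Pn) (ℤ.-1*i≡-i _))

  -- For an ascent the sign persists. For a descent the neighbours of the row are exchanged, which
  -- moves the entry of the previous row across the equation, and the change of sign makes up for
  -- this.
  signed-recurrence : ∀ {n j} → j ℕ.≤ n →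
    signed (2 ℕ.+ n) (2 ℕ.+ j) ≡ signed (2 ℕ.+ n) (suc j) ℤ.+ signed (suc n) (suc j)
  signed-recurrence {n} {j} j≤n with P n in Pn
  ... | true = begin
    ε₂ ℤ.* + ♯ P (2 ℕ.+ n) (2 ℕ.+ j)          ≡⟨ cong (λ k → ε₂ ℤ.* + k) (♯-ascent P n Pn j≤n) ⟩
    ε₂ ℤ.* (+ u ℤ.+ + v)                      ≡⟨ ℤ.*-distribˡ-+ ε₂ (+ u) (+ v) ⟩
    ε₂ ℤ.* + u ℤ.+ ε₂ ℤ.* + v                 ≡⟨ cong (λ e → ε₂ ℤ.* + u ℤ.+ e ℤ.* + v) (ε-ascent Pn) ⟩
    ε₂ ℤ.* + u ℤ.+ ε P (suc n) ℤ.* + v        ∎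
    where
    open ≡-Reasoning
    ε₂ = ε P (2 ℕ.+ n)
    u = ♯ P (2 ℕ.+ n) (suc j)
    v = ♯ P (suc n) (suc j)
  ... | false = sym (begin
    ε₂ ℤ.* + ♯ P (2 ℕ.+ n) (suc j) ℤ.+ ε₁ ℤ.* + v
      ≡⟨ cong (λ k → ε₂ ℤ.* + k ℤ.+ ε₁ ℤ.* + v) (♯-descent P n Pn j≤n) ⟩
    ε₂ ℤ.* (+ u ℤ.+ + v) ℤ.+ ε₁ ℤ.* + v
      ≡⟨ cong (ℤ._+ ε₁ ℤ.* + v) (ℤ.*-distribˡ-+ ε₂ (+ u) (+ v)) ⟩
    ε₂ ℤ.* + u ℤ.+ ε₂ ℤ.* + v ℤ.+ ε₁ ℤ.* + v
      ≡⟨ ℤ.+-assoc (ε₂ ℤ.* + u) _ _ ⟩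
    ε₂ ℤ.* + u ℤ.+ (ε₂ ℤ.* + v ℤ.+ ε₁ ℤ.* + v)
      ≡⟨ cong (λ e → ε₂ ℤ.* + u ℤ.+ (e ℤ.+ ε₁ ℤ.* + v))
           (trans (cong (ℤ._* + v) (ε-descent Pn)) (sym (ℤ.neg-distribˡ-* ε₁ (+ v)))) ⟩
    ε₂ ℤ.* + u ℤ.+ (ℤ.- (ε₁ ℤ.* + v) ℤ.+ ε₁ ℤ.* + v)
      ≡⟨ cong (λ k → ε₂ ℤ.* + u ℤ.+ k) (ℤ.+-inverseˡ (ε₁ ℤ.* + v)) ⟩
    ε₂ ℤ.* + u ℤ.+ + 0
      ≡⟨ ℤ.+-identityʳ _ ⟩
    ε₂ ℤ.* + u ∎)
    where
    open ≡-Reasoning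
    ε₁ = ε P (suc n)
    ε₂ = ε P (2 ℕ.+ n)
    u = ♯ P (2 ℕ.+ n) (2 ℕ.+ j)
    v = ♯ P (suc n) (suc j)

  coefficient-suc : ∀ a b → coefficient a (suc b) ≡ coefficient (suc a) b ℚ.+ coefficient a b
  coefficient-suc a b = trans
    (cong ι (trans (cong (λ k → signed (suc k) (2 ℕ.+ b)) (ℕ.+-suc a b))
      (signed-recurrence (ℕ.m≤n+m b a))))
    (ι-homo-+ (signed (2 ℕ.+ (a ℕ.+ b)) (suc b)) (signed (suc (a ℕ.+ b)) (suc b)))

  F-zero : ∀ a b → ♯ P (suc (a ℕ.+ b)) (suc b) ≡ 0 → F P a b ≡ 0ℚ
  F-zero a b eq = trans (F-coefficient a b) (trans
    (cong (ℚ._* (exp a ℚ.* exp b))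
      (cong ι (trans (cong (λ k → ε P (suc (a ℕ.+ b)) ℤ.* + k) eq) (ℤ.*-zeroʳ (ε P (suc (a ℕ.+ b)))))))
    (ℚ.*-zeroˡ (exp a ℚ.* exp b)))

  -- The coefficient of x^(n+1) belongs to permutations of length n + 2 ending in 1, and their last
  -- step is `P n`.
  F-ascent : ∀ n → P n ≡ true → F P (suc n) 0 ≡ 0ℚ
  F-ascent n Pn = F-zero (suc n) 0 (trans (cong (λ k → ♯ P (2 ℕ.+ k) 1) (ℕ.+-identityʳ n)) (♯-ascent-first P n Pn))

  F-descent : ∀ n → P n ≡ false → F P 0 (suc n) ≡ 0ℚ
  F-descent n Pn = F-zero 0 (suc n) (♯-descent-last P n Pn)

  F-origin : F P 0 0 ≡ 1ℚ
  F-origin = refl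

  private
    module DP = DividedPowers ℚ-ring exp
    module PS = PowerSeriesRing ℚ-ring
    module FS = FiniteSums ℚ-ring
    module PS₂ = PowerSeriesRing PS.commutativeRing

  -- The series multiplied by `exp` is the a-th derivative of f, so this is the Taylor expansion of
  -- e^y f(x + y) in powers of x.
  F-exp : ∀ a b → F P a b ≡ exp a ℚ.* (exp ℚ⟦t⟧.* (λ k → coefficient (a ℕ.+ k) 0 ℚ.* exp k)) b
  F-exp a b = begin
    F P a b                                    ≡⟨ F-coefficient a b ⟩
    coefficient a b ℚ.* (exp a ℚ.* exp b)      ≡⟨ x∙yz≈y∙xz (coefficient a b) (exp a) (exp b) ⟩
    exp a ℚ.* (coefficient a b ℚ.* exp b)
      ≡⟨ cong (exp a ℚ.*_) (DP.array-solution refl exp-suc ·-cancelˡ coefficient coefficient-suc b a) ⟩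
    exp a ℚ.* (exp ℚ⟦t⟧.* (λ k → coefficient (a ℕ.+ k) 0 ℚ.* exp k)) b ∎
    where
    open ≡-Reasoning

  F-row : ∀ n → F P n 0 ≡ coefficient n 0 ℚ.* exp n
  F-row n = trans (F-coefficient n 0) (cong (coefficient n 0 ℚ.*_) (ℚ.*-identityʳ (exp n)))

  F-column : ∀ n → F P 0 n ≡ (exp ℚ⟦t⟧.* (λ k → F P k 0)) n
  F-column n = trans (F-exp 0 n) (trans (ℚ.*-identityˡ _)
    (PS.⋆-cong exp exp (λ k → coefficient k 0 ℚ.* exp k) (λ k → F P k 0)
      (λ _ → refl) (λ k → sym (F-row k)) n))

  -- The series f is arbitrary up to pointwise equality, because it will be the quotient of the two
  -- determinants.
  F-series : ∀ f → (∀ n → f n ≡ F P n 0) → F P ℚ⟦x,y⟧.≈ (inY exp ℚ⟦x,y⟧.* (f ⟨ x ℚ⟦x,y⟧.+ y ⟩))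
  F-series f f≡F a b = begin
    F P a b
      ≡⟨ F-exp a b ⟩
    -- The factors are exchanged in order to draw `exp a` into v, since `⋆-scaleˡ` scales the left
    -- factor.
    exp a ℚ.* (exp ℚ⟦t⟧.* v) b
      ≡⟨ cong (exp a ℚ.*_) (PS.⋆-comm exp v b) ⟩
    exp a ℚ.* (v ℚ⟦t⟧.* exp) b
      ≡⟨ PS.⋆-scaleˡ (exp a) v exp b ⟨
    ((λ k → exp a ℚ.* v k) ℚ⟦t⟧.* exp) b
      ≡⟨ PS.⋆-cong (λ k → exp a ℚ.* v k) ((f ⟨ x ℚ⟦x,y⟧.+ y ⟩) a) exp exp
           (λ k → sym (substituted k)) (λ _ → refl) b ⟩
    ((f ⟨ x ℚ⟦x,y⟧.+ y ⟩) a ℚ⟦t⟧.* exp) b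
      ≡⟨ PS.⋆-comm ((f ⟨ x ℚ⟦x,y⟧.+ y ⟩) a) exp b ⟩
    (exp ℚ⟦t⟧.* (f ⟨ x ℚ⟦x,y⟧.+ y ⟩) a) b
      ≡⟨ PS₂.⋆-constantˡ exp (f ⟨ x ℚ⟦x,y⟧.+ y ⟩) a b ⟨
    (inY exp ℚ⟦x,y⟧.* (f ⟨ x ℚ⟦x,y⟧.+ y ⟩)) a b ∎
    where
    open ≡-Reasoning
    open import Algebra.Definitions.RawSemiring ℚ⟦x,y⟧.rawSemiring using (_^_)

    v : ℕ → ℚ
    v k = coefficient (a ℕ.+ k) 0 ℚ.* exp k

    -- By homogeneity only the power n = a + k contributes to this coefficient, and there the
    -- binomial formula applies.
    substituted : ∀ k → (f ⟨ x ℚ⟦x,y⟧.+ y ⟩) a k ≡ exp a ℚ.* v k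
    substituted k = begin
      (f ⟨ x ℚ⟦x,y⟧.+ y ⟩) a k
        ≡⟨ FS.sum-single (fromℕ (a ℕ.+ k)) (λ n → f (toℕ n) ℚ.* ((x ℚ⟦x,y⟧.+ y) ^ toℕ n) a k) off ⟩
      f (toℕ (fromℕ (a ℕ.+ k))) ℚ.* ((x ℚ⟦x,y⟧.+ y) ^ toℕ (fromℕ (a ℕ.+ k))) a k
        ≡⟨ cong (λ n → f n ℚ.* ((x ℚ⟦x,y⟧.+ y) ^ n) a k) (Fin.toℕ-fromℕ (a ℕ.+ k)) ⟩
      f n ℚ.* ((x ℚ⟦x,y⟧.+ y) ^ n) a k
        ≡⟨ cong (ℚ._* ((x ℚ⟦x,y⟧.+ y) ^ n) a k) (trans (f≡F n) (F-row n)) ⟩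
      coefficient n 0 ℚ.* exp n ℚ.* ((x ℚ⟦x,y⟧.+ y) ^ n) a k
        ≡⟨ ℚ.*-assoc (coefficient n 0) (exp n) _ ⟩
      coefficient n 0 ℚ.* (exp n ℚ.* ((x ℚ⟦x,y⟧.+ y) ^ n) a k)
        ≡⟨ cong (coefficient n 0 ℚ.*_) (DP.power-on refl exp-suc ·-cancelˡ n a k refl) ⟩
      coefficient n 0 ℚ.* (exp a ℚ.* exp k)
        ≡⟨ x∙yz≈y∙xz (coefficient n 0) (exp a) (exp k) ⟩
      exp a ℚ.* v k ∎
      where
      n = a ℕ.+ k
      off : ∀ i → i ≢ fromℕ (a ℕ.+ k) → f (toℕ i) ℚ.* ((x ℚ⟦x,y⟧.+ y) ^ toℕ i) a k ≡ 0ℚ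
      off i i≢ = trans (cong (f (toℕ i) ℚ.*_) (DP.power-off refl exp-suc ·-cancelˡ (toℕ i) a k
        λ eq → i≢ (Fin.toℕ-injective (trans (sym eq) (sym (Fin.toℕ-fromℕ (a ℕ.+ k)))))))
        (ℚ.*-zeroʳ (f (toℕ i)))

-- The linear system for the residue classes of f

monomial-on : ∀ a {k n} → k ≡ n → PowerSeries.monomial ℚ.+-*-rawRing a k n ≡ a
monomial-on a {k} refl with k ≡ᵇ k in eq
... | true  = refl
... | false = ⊥-elim (subst T eq (ℕ.≡⇒≡ᵇ k k refl))

monomial-off : ∀ a {k n} → k ≢ n → PowerSeries.monomial ℚ.+-*-rawRing a k n ≡ 0ℚ
monomial-off a {k} {n} k≢n with k ≡ᵇ n in eq
... | true  = ⊥-elim (k≢n (ℕ.≡ᵇ⇒≡ k n (subst T (sym eq) _)))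
... | false = refl

-- Residues modulo m and the coefficients of Olivier functions

module Residues (m : ℕ) .{{_ : NonZero m}} where

  open ≡-Reasoning

  %-+ : ∀ a b → (a % m ℕ.+ b % m) % m ≡ (a ℕ.+ b) % m
  %-+ a b = sym (ℕ.%-distribˡ-+ a b m)

  %-cancelʳ : ∀ {a b} c → a ℕ.< m → b ℕ.< m → (a ℕ.+ c) % m ≡ (b ℕ.+ c) % m → a ≡ b
  %-cancelʳ {a} {b} c a<m b<m eq = begin
    a                                ≡⟨ shift a a<m ⟨
    ((a ℕ.+ c) % m ℕ.+ d % m) % m    ≡⟨ cong (λ k → (k ℕ.+ d % m) % m) eq ⟩
    ((b ℕ.+ c) % m ℕ.+ d % m) % m    ≡⟨ shift b b<m ⟩
    b                                ∎
    where
    -- A natural number that serves as the negative of c modulo m.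
    d = m ∸ c % m
    c+d : (c ℕ.+ d) % m ≡ 0
    c+d = begin
      (c ℕ.+ d) % m                    ≡⟨ %-+ c d ⟨
      (c % m ℕ.+ d % m) % m            ≡⟨ cong (λ k → (k ℕ.+ d % m) % m) (ℕ.m%n%n≡m%n c m) ⟨
      (c % m % m ℕ.+ d % m) % m        ≡⟨ %-+ (c % m) d ⟩
      (c % m ℕ.+ d) % m                ≡⟨ cong (_% m) (ℕ.m+[n∸m]≡n (ℕ.<⇒≤ (ℕ.m%n<n c m))) ⟩
      m % m                            ≡⟨ ℕ.n%n≡0 m ⟩
      0                                ∎
    shift : ∀ a → a ℕ.< m → ((a ℕ.+ c) % m ℕ.+ d % m) % m ≡ a
    shift a a<m = begin
      ((a ℕ.+ c) % m ℕ.+ d % m) % m    ≡⟨ %-+ (a ℕ.+ c) d ⟩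
      (a ℕ.+ c ℕ.+ d) % m              ≡⟨ cong (_% m) (ℕ.+-assoc a c d) ⟩
      (a ℕ.+ (c ℕ.+ d)) % m            ≡⟨ %-+ a (c ℕ.+ d) ⟨
      (a % m ℕ.+ (c ℕ.+ d) % m) % m    ≡⟨ cong (λ k → (a % m ℕ.+ k) % m) c+d ⟩
      (a % m ℕ.+ 0) % m                ≡⟨ cong (_% m) (ℕ.+-identityʳ (a % m)) ⟩
      a % m % m                        ≡⟨ ℕ.m%n%n≡m%n a m ⟩
      a % m                            ≡⟨ ℕ.m<n⇒m%n≡m a<m ⟩
      a                                ∎

  -- The index of the Olivier function in a matrix entry; k and l are the positions i_k and i_l
  -- themselves, not the numbers of row and column.
  residue : ℕ → ℕ → ℕ
  residue k l = (+ k ℤ.- + l) %ℕ m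

  residue-+ : ∀ {k} l → k ℕ.< m → (residue k l ℕ.+ l) % m ≡ k
  residue-+ {k} l k<m = trans (helper ((+ k ℤ.- + l) /ℕ m) decomposition) (ℕ.m<n⇒m%n≡m k<m)
    where
    ρ = residue k l

    decomposition : + k ≡ + (ρ ℕ.+ l) ℤ.+ ((+ k ℤ.- + l) /ℕ m) ℤ.* + m
    decomposition = begin
      + k                                  ≡⟨ ℤ.+-identityʳ (+ k) ⟨
      + k ℤ.+ + 0                          ≡⟨ cong (λ i → + k ℤ.+ i) (ℤ.+-inverseˡ (+ l)) ⟨
      + k ℤ.+ (ℤ.- + l ℤ.+ + l)            ≡⟨ ℤ.+-assoc (+ k) (ℤ.- + l) (+ l) ⟨
      (+ k ℤ.- + l) ℤ.+ + l                ≡⟨ cong (ℤ._+ + l) (a≡a%ℕn+[a/ℕn]*n (+ k ℤ.- + l) m) ⟩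
      + ρ ℤ.+ q ℤ.* + m ℤ.+ + l            ≡⟨ ℤ.+-assoc (+ ρ) (q ℤ.* + m) (+ l) ⟩
      + ρ ℤ.+ (q ℤ.* + m ℤ.+ + l)          ≡⟨ cong (λ i → + ρ ℤ.+ i) (ℤ.+-comm (q ℤ.* + m) (+ l)) ⟩
      + ρ ℤ.+ (+ l ℤ.+ q ℤ.* + m)          ≡⟨ ℤ.+-assoc (+ ρ) (+ l) (q ℤ.* + m) ⟨
      + (ρ ℕ.+ l) ℤ.+ q ℤ.* + m            ∎
      where q = (+ k ℤ.- + l) /ℕ m

    -- The quotient is negative when k < l; its multiple of m is then moved to the other side, so
    -- that the congruence can be read in the natural numbers.
    helper : ∀ q → + k ≡ + (ρ ℕ.+ l) ℤ.+ q ℤ.* + m → (ρ ℕ.+ l) % m ≡ k % m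
    helper (+ t) eq = sym (trans (cong (_% m) (ℤ.+-injective
      (trans eq (cong (λ i → + (ρ ℕ.+ l) ℤ.+ i) (sym (ℤ.pos-* t m))))))
      (ℕ.[m+kn]%n≡m%n (ρ ℕ.+ l) t m))
    helper -[1+ t ] eq = trans (cong (_% m) (ℤ.+-injective (sym (begin
      + (k ℕ.+ suc t ℕ.* m)                      ≡⟨ cong (λ i → + k ℤ.+ i) (ℤ.pos-* (suc t) m) ⟩
      + k ℤ.+ + suc t ℤ.* + m                    ≡⟨ cong (ℤ._+ + suc t ℤ.* + m) eq ⟩
      + (ρ ℕ.+ l) ℤ.+ -[1+ t ] ℤ.* + m ℤ.+ + suc t ℤ.* + m
        ≡⟨ ℤ.+-assoc (+ (ρ ℕ.+ l)) (-[1+ t ] ℤ.* + m) (+ suc t ℤ.* + m) ⟩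
      + (ρ ℕ.+ l) ℤ.+ (-[1+ t ] ℤ.* + m ℤ.+ + suc t ℤ.* + m)
        ≡⟨ cong (λ i → + (ρ ℕ.+ l) ℤ.+ i) (ℤ.*-distribʳ-+ (+ m) -[1+ t ] (+ suc t)) ⟨
      + (ρ ℕ.+ l) ℤ.+ (-[1+ t ] ℤ.+ + suc t) ℤ.* + m
        ≡⟨ cong (λ i → + (ρ ℕ.+ l) ℤ.+ i ℤ.* + m) (ℤ.+-inverseˡ (+ suc t)) ⟩
      + (ρ ℕ.+ l) ℤ.+ + 0
        ≡⟨ ℤ.+-identityʳ _ ⟩
      + (ρ ℕ.+ l) ∎)))) (ℕ.[m+kn]%n≡m%n k (suc t) m)

  -- Here a is an exponent of a matrix entry and b one of an unknown in class l. Together with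
  -- `residue⁻` it says that the product lands in class k exactly for the exponents a that the entry
  -- (k, l) carries.
  residue⁺ : ∀ {k l} a b → k ℕ.< m → b % m ≡ l → (a ℕ.+ b) % m ≡ k → a % m ≡ residue k l
  residue⁺ {k} {l} a b k<m b≡l a+b≡k =
    %-cancelʳ l (ℕ.m%n<n a m) (n%ℕd<d (+ k ℤ.- + l) m) (begin
      (a % m ℕ.+ l) % m          ≡⟨ cong (λ i → (a % m ℕ.+ i) % m) b≡l ⟨
      (a % m ℕ.+ b % m) % m      ≡⟨ %-+ a b ⟩
      (a ℕ.+ b) % m              ≡⟨ a+b≡k ⟩
      k                          ≡⟨ residue-+ l k<m ⟨
      (residue k l ℕ.+ l) % m    ∎)

  residue⁻ : ∀ {k l} a b → k ℕ.< m → b % m ≡ l → a % m ≡ residue k l → (a ℕ.+ b) % m ≡ k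
  residue⁻ {k} {l} a b k<m b≡l a≡ρ = begin
    (a ℕ.+ b) % m              ≡⟨ %-+ a b ⟨
    (a % m ℕ.+ b % m) % m      ≡⟨ cong₂ (λ i j → (i ℕ.+ j) % m) a≡ρ b≡l ⟩
    (residue k l ℕ.+ l) % m    ≡⟨ residue-+ l k<m ⟩
    k                          ∎

  private
    module FS = FiniteSums ℚ-ring

  φ-on : ∀ i n → n % m ≡ i → φ m i n ≡ exp n
  φ-on i n n≡i = begin
    φ m i n
      ≡⟨ FS.sum-single q t (λ j j≢q → monomial-off (exp (toℕ j ℕ.* m ℕ.+ i)) λ eq →
           j≢q (Fin.toℕ-injective (ℕ.*-cancelʳ-≡ (toℕ j) (toℕ q) m
             (ℕ.+-cancelʳ-≡ i _ _ (trans eq (sym at-q)))))) ⟩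
    t q
      ≡⟨ monomial-on (exp (toℕ q ℕ.* m ℕ.+ i)) at-q ⟩
    exp (toℕ q ℕ.* m ℕ.+ i)
      ≡⟨ cong exp at-q ⟩
    exp n ∎
    where
    q : Fin (suc n)
    -- The only j with jm + i = n; as n / m is at most n, it lies within the truncated sum.
    q = fromℕ< (ℕ.s≤s (ℕ.m/n≤m n m))
    t : Fin (suc n) → ℚ
    t j = PowerSeries.monomial ℚ.+-*-rawRing (exp (toℕ j ℕ.* m ℕ.+ i)) (toℕ j ℕ.* m ℕ.+ i) n
    at-q : toℕ q ℕ.* m ℕ.+ i ≡ n
    at-q = begin
      toℕ q ℕ.* m ℕ.+ i        ≡⟨ cong₂ (λ a b → a ℕ.* m ℕ.+ b) (Fin.toℕ-fromℕ< (ℕ.s≤s (ℕ.m/n≤m n m))) (sym n≡i) ⟩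
      n / m ℕ.* m ℕ.+ n % m    ≡⟨ ℕ.+-comm (n / m ℕ.* m) (n % m) ⟩
      n % m ℕ.+ n / m ℕ.* m    ≡⟨ ℕ.m≡m%n+[m/n]*n n m ⟨
      n                        ∎

  φ-off : ∀ i n → i ℕ.< m → n % m ≢ i → φ m i n ≡ 0ℚ
  φ-off i n i<m n≢i = FS.sum-zero t λ j → monomial-off (exp (toℕ j ℕ.* m ℕ.+ i)) λ eq → n≢i (begin
    n % m                        ≡⟨ cong (_% m) eq ⟨
    (toℕ j ℕ.* m ℕ.+ i) % m      ≡⟨ cong (_% m) (ℕ.+-comm (toℕ j ℕ.* m) i) ⟩
    (i ℕ.+ toℕ j ℕ.* m) % m      ≡⟨ ℕ.[m+kn]%n≡m%n i (toℕ j) m ⟩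
    i % m                        ≡⟨ ℕ.m<n⇒m%n≡m i<m ⟩
    i                            ∎)
    where
    t : Fin (suc n) → ℚ
    t j = PowerSeries.monomial ℚ.+-*-rawRing (exp (toℕ j ℕ.* m ℕ.+ i)) (toℕ j ℕ.* m ℕ.+ i) n

-- The linear system for a periodic sequence with r + 1 zeros per period

module Solution (m : ℕ) .{{_ : NonZero m}} (p : Vec Bool m) (r : ℕ) (z : Fin (suc r) → Fin m)
  (z-mono : z Preserves Fin._<_ ⟶ Fin._<_)
  (zeros : ∀ k → lookup p k ≡ false ⇔ (∃[ s ] z s ≡ k))
  (last≡m : suc (toℕ (z (fromℕ r))) ≡ m) where

  open Residues m
  open ≡-Reasoning

  private
    module FS  = FiniteSums ℚ-ring
    module PS  = PowerSeriesRing ℚ-ring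
    module FSS = FiniteSums PS.commutativeRing
    module DP  = DeterminantProperties PS.commutativeRing
    module CT  = ConstantTerm ℚ-ring

    P : ℕ → Bool
    P = periodic p

    -- The list i_0, i_1, ... without its last member m, which is congruent to i_0. What remains is
    -- distinct modulo m.
    q : Fin (suc r) → ℕ
    q l = positions z (inject₁ l)

    f : ℚ⟦t⟧.Carrier
    f n = F P n 0

  q<m : ∀ l → q l ℕ.< m
  q<m zero    = ℕ.>-nonZero⁻¹ m
  q<m (suc l) = subst (suc (toℕ (z (inject₁ l))) ℕ.<_) last≡m (ℕ.s≤s (z-mono
    (subst (toℕ (inject₁ l) ℕ.<_) (sym (Fin.toℕ-fromℕ r)) (Fin.inject₁ℕ< l))))

  z-injective : ∀ {s t} → z s ≡ z t → s ≡ t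
  z-injective {s} {t} eq with Fin.<-cmp s t
  ... | tri< s<t _ _ = ⊥-elim (Fin.<⇒≢ (z-mono s<t) eq)
  ... | tri≈ _ s≡t _ = s≡t
  ... | tri> _ _ t<s = ⊥-elim (Fin.<⇒≢ (z-mono t<s) (sym eq))

  q-injective : ∀ k l → q k ≡ q l → k ≡ l
  q-injective zero    zero    _  = refl
  q-injective (suc k) (suc l) eq = cong suc (Fin.inject₁-injective
    (z-injective (Fin.toℕ-injective (ℕ.suc-injective eq))))

  suc-% : ∀ n → suc n % m ≡ suc (n % m) % m
  suc-% n = trans (cong (λ k → suc k % m) (ℕ.m≡m%n+[m/n]*n n m))
              (ℕ.[m+kn]%n≡m%n (suc (n % m)) (n / m) m)

  suc-%-cases : ∀ n → (suc n % m ≡ suc (n % m)) ⊎ (suc (n % m) ≡ m × suc n % m ≡ 0)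
  suc-%-cases n with ℕ.m≤n⇒m<n∨m≡n (ℕ.m%n<n n m)
  ... | inj₁ <m = inj₁ (trans (suc-% n) (ℕ.m<n⇒m%n≡m <m))
  ... | inj₂ ≡m = inj₂ (≡m , trans (suc-% n) (trans (cong (_% m) ≡m) (ℕ.n%n≡0 m)))

  toℕ-mod : ∀ n → toℕ (n mod m) ≡ n % m
  toℕ-mod n = Fin.toℕ-fromℕ< (ℕ.m%n<n n m)

  -- `P n` is p_(n+1), so it governs the exponent n + 1. Inside a period the residue of n + 1 is the
  -- position of the zero itself; at the end of a period it wraps around to i_0 = 0.
  descent⇒position : ∀ n → P n ≡ false → ∃ λ l → suc n % m ≡ q l
  descent⇒position n Pn with Equivalence.to (zeros (n mod m)) Pn
  ... | s , zs≡n with view s | suc-%-cases n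
  ...   | _                | inj₂ (_ , ≡0) = zero , ≡0
  -- The last zero sits at position m, where the residue must wrap around.
  ...   | ‵fromℕ           | inj₁ suc-n = ⊥-elim (ℕ.<⇒≢ (ℕ.m%n<n (suc n) m) (begin
    suc n % m                   ≡⟨ suc-n ⟩
    suc (n % m)                 ≡⟨ cong suc (trans (cong toℕ zs≡n) (toℕ-mod n)) ⟨
    suc (toℕ (z (fromℕ r)))     ≡⟨ last≡m ⟩
    m                           ∎))
  ...   | ‵inject₁ l      | inj₁ suc-n = suc l , (begin
    suc n % m                   ≡⟨ suc-n ⟩
    suc (n % m)                 ≡⟨ cong suc (trans (cong toℕ zs≡n) (toℕ-mod n)) ⟨
    suc (toℕ (z (inject₁ l)))   ∎)

  position⇒descent : ∀ n l → suc n % m ≡ q l → P n ≡ false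
  position⇒descent n zero eq with suc-%-cases n
  ... | inj₁ suc-n    with () ← trans (sym suc-n) eq
  -- A positive exponent divisible by m belongs to the end of a period, and p_m = 0.
  ... | inj₂ (≡m , _) = Equivalence.from (zeros (n mod m)) (fromℕ r , Fin.toℕ-injective
    (trans (ℕ.suc-injective (trans last≡m (sym ≡m))) (sym (toℕ-mod n))))
  position⇒descent n (suc l) eq with suc-%-cases n
  ... | inj₁ suc-n    = Equivalence.from (zeros (n mod m)) (inject₁ l , Fin.toℕ-injective
    (trans (ℕ.suc-injective (trans (sym eq) suc-n)) (sym (toℕ-mod n))))
  ... | inj₂ (_ , ≡0) with () ← trans (sym ≡0) eq

  f-off : ∀ n → (∀ l → n % m ≢ q l) → f n ≡ 0ℚ
  f-off zero    n≢q = ⊥-elim (n≢q zero (ℕ.m*n%n≡0 0 m))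
  f-off (suc n) n≢q with P n in Pn
  ... | true  = F-ascent P n Pn
  ... | false = let l , eq = descent⇒position n Pn in ⊥-elim (n≢q l eq)

  part : Fin (suc r) → ℚ⟦t⟧.Carrier
  part l n = if does (n % m ℕ.≟ q l) then f n else 0ℚ

  part-on : ∀ l n → n % m ≡ q l → part l n ≡ f n
  part-on l n eq = cong (if_then f n else 0ℚ) (dec-true (n % m ℕ.≟ q l) eq)

  part-off : ∀ l n → n % m ≢ q l → part l n ≡ 0ℚ
  part-off l n neq = cong (if_then f n else 0ℚ) (dec-false (n % m ℕ.≟ q l) neq)

  -- Outside its class `part l` vanishes, so the factor beside it can be changed there at will.
  *-part : ∀ l n c d → (n % m ≡ q l → c ≡ d) → c ℚ.* part l n ≡ d ℚ.* part l n
  *-part l n c d c≡d = by-cases (n % m ℕ.≟ q l)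
    where
    by-cases : Dec (n % m ≡ q l) → c ℚ.* part l n ≡ d ℚ.* part l n
    by-cases (yes n≡q) = cong (ℚ._* part l n) (c≡d n≡q)
    by-cases (no n≢q)  = begin
      c ℚ.* part l n   ≡⟨ cong (c ℚ.*_) (part-off l n n≢q) ⟩
      c ℚ.* 0ℚ         ≡⟨ ℚ.*-zeroʳ c ⟩
      0ℚ               ≡⟨ ℚ.*-zeroʳ d ⟨
      d ℚ.* 0ℚ         ≡⟨ cong (d ℚ.*_) (part-off l n n≢q) ⟨
      d ℚ.* part l n   ∎

  sum-part : ∀ n → FSS.sum part n ≡ f n
  sum-part n = trans (PS.sum-coefficient part n) pointwise
    where
    pointwise : FS.sum (λ l → part l n) ≡ f n
    pointwise with Fin.any? (λ l → n % m ℕ.≟ q l)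
    ... | yes (l , eq) = trans
      (FS.sum-single l (λ l → part l n) λ j j≢l → part-off j n λ eq′ →
        j≢l (q-injective j l (trans (sym eq′) eq)))
      (part-on l n eq)
    ... | no n∉q = trans (FS.sum-zero (λ l → part l n) λ l → part-off l n λ eq → n∉q (l , eq))
      (sym (f-off n λ l eq → n∉q (l , eq)))

  N : Fin (suc r) → Fin (suc r) → ℚ⟦t⟧.Carrier
  N = M m (positions z)

  row : Fin (suc r) → Fin (suc r) → ℚ⟦t⟧.Carrier
  row k l = N k l ℚ⟦t⟧.* part l

  -- In a total degree of class `q k`, every contributing exponent of the entry lies in its own
  -- residue class, where the Olivier function and e^t have the same coefficients. So the row yields
  -- the coefficient of e^t f.
  sum-row-on : ∀ k n → n % m ≡ q k → FSS.sum (row k) n ≡ F P 0 n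
  sum-row-on k n n≡q = begin
    FSS.sum (row k) n
      ≡⟨ PS.sum-coefficient (row k) n ⟩
    FS.sum (λ l → row k l n)
      ≡⟨ FS.sum-cong (λ l → row k l n) (λ l → (exp ℚ⟦t⟧.* part l) n) (λ l →
           PS.⋆-local (N k l) exp (part l) (part l) n (product l)) ⟩
    FS.sum (λ l → (exp ℚ⟦t⟧.* part l) n)
      ≡⟨ PS.sum-coefficient (λ l → exp ℚ⟦t⟧.* part l) n ⟨
    FSS.sum (λ l → exp ℚ⟦t⟧.* part l) n
      ≡⟨ FSS.*-distribˡ-sum exp part n ⟨
    (exp ℚ⟦t⟧.* FSS.sum part) n
      ≡⟨ PS.⋆-cong exp exp (FSS.sum part) f (λ _ → refl) sum-part n ⟩
    (exp ℚ⟦t⟧.* f) n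
      ≡⟨ F-column P n ⟨
    F P 0 n ∎
    where
    product : ∀ l a b → a ℕ.+ b ≡ n → N k l a ℚ.* part l b ≡ exp a ℚ.* part l b
    product l a b a+b≡n = *-part l b (N k l a) (exp a) λ b≡q →
      φ-on _ a (residue⁺ a b (q<m k) b≡q (trans (cong (_% m) a+b≡n) n≡q))

  -- An exponent of the entry plus one of `part l` always lies in class `q k`, so no product reaches
  -- the other degrees.
  sum-row-off : ∀ k n → n % m ≢ q k → FSS.sum (row k) n ≡ 0ℚ
  sum-row-off k n n≢q = trans (PS.sum-coefficient (row k) n)
    (FS.sum-zero (λ l → row k l n) λ l → trans
      (PS.⋆-local (N k l) ℚ⟦t⟧.0# (part l) (part l) n (product l))
      (PS.⋆-zeroˡ ℚ⟦t⟧.0# (part l) (λ _ → refl) n))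
    where
    product : ∀ l a b → a ℕ.+ b ≡ n → N k l a ℚ.* part l b ≡ 0ℚ ℚ.* part l b
    product l a b a+b≡n = *-part l b (N k l a) 0ℚ λ b≡q →
      φ-off _ a (n%ℕd<d (+ q k ℤ.- + q l) m) λ a≡ρ →
        n≢q (trans (cong (_% m) (sym a+b≡n)) (residue⁻ a b (q<m k) b≡q a≡ρ))

  sum-row-zero : ∀ n → FSS.sum (row zero) n ≡ ℚ⟦t⟧.1# n
  -- Degree 0 lies in the class of i_0 but follows no step of `P`; it contributes the 1 of the
  -- right-hand side.
  sum-row-zero zero    = trans (sum-row-on zero 0 (ℕ.m*n%n≡0 0 m)) (F-origin P)
  sum-row-zero (suc n) with suc n % m ℕ.≟ 0
  ... | yes eq = trans (sum-row-on zero (suc n) eq) (F-descent P n (position⇒descent n zero eq))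
  ... | no neq = sum-row-off zero (suc n) neq

  sum-row-suc : ∀ k n → FSS.sum (row (suc k)) n ≡ 0ℚ
  sum-row-suc k n with n % m ℕ.≟ q (suc k)
  sum-row-suc k n       | no neq = sum-row-off (suc k) n neq
  sum-row-suc k zero    | yes eq with () ← trans (sym (ℕ.m*n%n≡0 0 m)) eq
  sum-row-suc k (suc n) | yes eq = trans (sum-row-on (suc k) (suc n) eq)
    (F-descent P n (position⇒descent n (suc k) eq))

  det-M̄ : det (M̄ m (positions z)) ℚ⟦t⟧.≈ f ℚ⟦t⟧.* det N
  det-M̄ n = trans
    (DP.cramer N (M̄ m (positions z)) part sum-row-zero sum-row-suc
      (λ _ _ → refl) (λ _ _ _ → refl) n)
    (PS.⋆-cong (FSS.sum part) f (det N) (det N) sum-part (λ _ → refl) n)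

  -- An Olivier function has constant term 1 for index 0 and 0 otherwise, and the index i_k - i_l
  -- modulo m is 0 only on the diagonal.
  constantTerm-N : det N 0 ≡ 1ℚ
  constantTerm-N = CT.constantTerm-det N
    (λ k → φ-on _ 0 (residue⁺ 0 (q k) (q<m k) (ℕ.m<n⇒m%n≡m (q<m k)) (ℕ.m<n⇒m%n≡m (q<m k))))
    (λ k l l≢k → φ-off _ 0 (n%ℕd<d (+ q k ℤ.- + q l) m) λ 0≡ρ → l≢k (q-injective l k (trans
      (sym (ℕ.m<n⇒m%n≡m (q<m l)))
      (residue⁻ 0 (q l) (q<m k) (ℕ.m<n⇒m%n≡m (q<m l)) 0≡ρ))))

  unit : Unit (det N)
  unit = PS.invertible (det N) constantTerm-N

  quotient≈f : ∀ n → quotient (det (M̄ m (positions z))) (det N) unit n ≡ f n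
  quotient≈f n = begin
    (det (M̄ m (positions z)) ℚ⟦t⟧.* g) n
      ≡⟨ PS.⋆-cong (det (M̄ m (positions z))) (f ℚ⟦t⟧.* det N) g g det-M̄ (λ _ → refl) n ⟩
    ((f ℚ⟦t⟧.* det N) ℚ⟦t⟧.* g) n
      ≡⟨ PS.⋆-assoc f (det N) g n ⟩
    (f ℚ⟦t⟧.* (det N ℚ⟦t⟧.* g)) n
      ≡⟨ PS.⋆-cong f f (det N ℚ⟦t⟧.* g) ℚ⟦t⟧.1# (λ _ → refl) (proj₂ (proj₂ unit)) n ⟩
    (f ℚ⟦t⟧.* ℚ⟦t⟧.1#) n
      ≡⟨ PS.⋆-comm f ℚ⟦t⟧.1# n ⟩
    (ℚ⟦t⟧.1# ℚ⟦t⟧.* f) n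
      ≡⟨ PS.⋆-identityˡ f n ⟩
    f n ∎
    where g = proj₁ unit

theorem1 : (m : ℕ) .{{_ : NonZero m}} → 1 ℕ.< m →
    (p : Vec Bool m) (r : ℕ) (z : Fin r → Fin m) →
    z Preserves Fin._<_ ⟶ Fin._<_ →
    (∀ k → lookup p k ≡ false ⇔ (∃[ s ] z s ≡ k)) →
    positions z (fromℕ r) ≡ m →
    Σ[ u ∈ Unit (det (M m (positions z))) ]
    F (periodic p)
    ℚ⟦x,y⟧.≈
    (inY exp ℚ⟦x,y⟧.*
    (quotient (det (M̄ m (positions z))) (det (M m (positions z))) u
    ⟨ x ℚ⟦x,y⟧.+ y ⟩))
-- Without zeros the last position would be i_0 = 0, which cannot equal m.
theorem1 m 1<m p zero    z z-mono zeros 0≡m    = ⊥-elim (ℕ.n≮0 (subst (1 ℕ.<_) (sym 0≡m) 1<m))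
theorem1 m 1<m p (suc r) z z-mono zeros last≡m =
  unit , F-series (periodic p) _ quotient≈f
  where open Solution m p r z z-mono zeros last≡m
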